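{- Let $p$ be a prime, $r\ge 1$ an integer, and let $f\in\mathbb{Q}[x]$ be a $p^r$-pure polynomial of degree $d$. Then for every $n\ge 1$, the iterate $f^n$ has at most $\gcd(d^n,r)$ irreducible factors over $\mathbb{Q}$, and each irreducible factor of $f^n$ has degree at least $\frac{d^n}{\gcd(d^n,r)}$. Moreover, $f$ is eventually stable over $\mathbb{Q}$.
   Context: $\nu_p$ denotes the $p$-adic valuation on $\mathbb{Q}$ (with $\nu_p(0)=\infty$). A polynomial $f(x)=a_dx^d+\dots+a_0\in\mathbb{Q}[x]$ of degree $d$ is $p^r$-pure if $\nu_p(a_d)=0$, $\nu_p(a_0)=r$, and $\frac{\nu_p(a_i)}{d-i}\ge \frac{r}{d}$ for all $1\le i\le d-1$. $f^n$ denotes the $n$-fold composition $f\circ\cdots\circ f$. A polynomial $f\in\mathbb{Q}[x]$ is eventually stable over $\mathbb{Q}$ if there is a constant $C$ such that the number of irreducible factors over $\mathbb{Q}$ of $f^n$ is at most $C$ for all $n\ge 1$. -}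

module Defs where

open import Data.Nat as ℕ using (ℕ; zero; suc; _∸_; _^_)
open import Data.Nat.Divisibility using (_∣_)
open import Data.Integer as ℤ using (ℤ; +_)
open import Data.Rational as ℚ using (ℚ; 0ℚ; 1ℚ)
open import Data.List using (List; []; _∷_; length; map)
open import Data.Product using (Σ; ∃; _×_; _,_)
open import Data.Sum using (_⊎_)
open import Data.List.Membership.Propositional using (_∈_)
open import Relation.Nullary using (¬_; yes; no)
open import Relation.Binary.PropositionalEquality using (_≡_)

-- Polynomials over ℚ as coefficient lists, lowest degree first:
-- a₀ ∷ a₁ ∷ … ∷ a_d ∷ []  represents  a₀ + a₁x + … + a_d x^d.
-- Trailing zeros are allowed; equality of polynomials is ≈ₚ below.

Poly : Set
Poly = List ℚ

trim : Poly → Poly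
trim [] = []
trim (a ∷ f) with trim f
... | [] with a ℚ.≟ 0ℚ
...   | yes _ = []
...   | no  _ = a ∷ []
trim (a ∷ f) | b ∷ g = a ∷ b ∷ g

_≈ₚ_ : Poly → Poly → Set
f ≈ₚ g = trim f ≡ trim g

-- degree (the zero polynomial gets degree 0 by convention)
deg : Poly → ℕ
deg f = length (trim f) ∸ 1

coeff : Poly → ℕ → ℚ
coeff []      _       = 0ℚ
coeff (a ∷ f) zero    = a
coeff (a ∷ f) (suc i) = coeff f i

_+ₚ_ : Poly → Poly → Poly
[]      +ₚ g       = g
(a ∷ f) +ₚ []      = a ∷ f
(a ∷ f) +ₚ (b ∷ g) = (a ℚ.+ b) ∷ (f +ₚ g)

_*ₚ_ : Poly → Poly → Poly
[]      *ₚ g = []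
(a ∷ f) *ₚ g = map (a ℚ.*_) g +ₚ (0ℚ ∷ (f *ₚ g))

_∘ₚ_ : Poly → Poly → Poly
[]      ∘ₚ g = []
(a ∷ f) ∘ₚ g = (a ∷ []) +ₚ (g *ₚ (f ∘ₚ g))

iter : Poly → ℕ → Poly
iter f zero    = 0ℚ ∷ 1ℚ ∷ []
iter f (suc n) = f ∘ₚ iter f n

prodₚ : List Poly → Poly
prodₚ []       = 1ℚ ∷ []
prodₚ (g ∷ gs) = g *ₚ prodₚ gs

_∣ₚ_ : Poly → Poly → Set
g ∣ₚ f = Σ Poly λ h → f ≈ₚ (g *ₚ h)

-- irreducible over ℚ: nonconstant, and every factorisation g = h·k has
-- a unit (nonzero constant, i.e. degree 0) factor
Irreducible : Poly → Set
Irreducible g = (1 ℕ.≤ deg g) ×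
  ((h k : Poly) → g ≈ₚ (h *ₚ k) → (deg h ≡ 0) ⊎ (deg k ≡ 0))

-- ν_p(n) = k for a natural number n (only possible for n ≠ 0)
ValN : ℕ → ℕ → ℕ → Set
ValN p n k = ((p ^ k) ∣ n) × ¬ ((p ^ suc k) ∣ n)

-- ν_p(q) = v for a rational q = a/b in lowest terms (only possible for
-- q ≠ 0): ν_p(q) = ν_p(|a|) − ν_p(b).
ValQ : ℕ → ℚ → ℤ → Set
ValQ p q v = ∃ λ k₁ → ∃ λ k₂ →
  ValN p ℤ.∣ ℚ.numerator q ∣ k₁ × ValN p (ℚ.denominatorℕ q) k₂ ×
  (v ≡ (+ k₁) ℤ.- (+ k₂))

-- f is p^r-pure (d = deg f):
--   ν_p(a_d) = 0, ν_p(a_0) = r, and for 1 ≤ i ≤ d−1,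
--   ν_p(a_i)/(d−i) ≥ r/d, i.e. either a_i = 0 (ν = ∞) or d·ν_p(a_i) ≥ r·(d−i).
Pure : ℕ → ℕ → Poly → Set
Pure p r f =
  ValQ p (coeff f (deg f)) (+ 0) ×
  ValQ p (coeff f 0) (+ r) ×
  ((i : ℕ) → 1 ℕ.≤ i → i ℕ.< deg f →
     (coeff f i ≡ 0ℚ) ⊎
     (∃ λ v → ValQ p (coeff f i) v × (+ (r ℕ.* (deg f ∸ i)) ℤ.≤ (+ deg f) ℤ.* v)))

IrredFactorisation : Poly → ℚ → List Poly → Set
IrredFactorisation F c gs =
  (F ≈ₚ ((c ∷ []) *ₚ prodₚ gs)) × ((g : Poly) → g ∈ gs → Irreducible g)

EventuallyStable : Poly → Set
EventuallyStable f = ∃ λ C → (n : ℕ) → 1 ℕ.≤ n →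
  (c : ℚ) (gs : List Poly) → IrredFactorisation (iter f n) c gs → length gs ℕ.≤ C

{-# OPTIONS --safe #-}

-- Let s = r / dⁿ. Composition of polynomials whose Newton polygon lies above the expected
-- segment again gives such a polynomial, so for d ≥ 2 every fⁿ is pʳ-pure: its Newton polygon
-- is the single segment from (0 , r) to (dⁿ , 0). The weighted Gauss valuation
-- min (ν(aᵢ) + i s) is multiplicative, which forces every factor g of fⁿ to attain its
-- minimum at both ends; hence s · deg g = ν(g(0)) − ν(lead g) is an integer, so that dⁿ
-- divides r · deg g, and deg g ≥ dⁿ / gcd(dⁿ, r). Adding up degrees bounds the number of
-- factors, and gcd(dⁿ, r) ≤ r is a bound independent of n. For d = 1 an iterate need not be
-- pure (for f = x + pʳ the constant term of fᵖ is pʳ⁺¹), but then dⁿ = 1 and there is nothing to prove.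
module Submission where

open import Defs
open import Data.Nat using (ℕ; zero; suc; _+_; _*_; _∸_; _^_; _≤_; _<_; z≤n; s≤s)
import Data.Nat as ℕ
import Data.Nat.Properties as ℕ
import Data.Nat.Divisibility as ℕ
open import Data.Nat.GCD using (gcd; gcd-greatest; gcd[m,n]≤n; gcd[m,n]≢0; c*gcd[m,n]≡gcd[cm,cn])
open import Data.Nat.Primality using (Prime; euclidsLemma; prime⇒nonZero; prime⇒nonTrivial)
open import Data.Integer as ℤ using (ℤ; +_; ∣_∣; 0ℤ; 1ℤ)
import Data.Integer.Properties as ℤ
open import Data.Integer.Divisibility.Signed as ℤ using (_∣_; divides; ∣ᵤ⇒∣; ∣⇒∣ᵤ)
open import Data.Integer.Tactic.RingSolver using (solve-∀)
open import Data.Rational as ℚ using (ℚ; 0ℚ; 1ℚ)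
import Data.Rational.Properties as ℚ
open import Data.Rational.Unnormalised as ℚᵘ using (mkℚᵘ; *≡*)
import Data.Rational.Unnormalised.Properties as ℚᵘ
open import Data.Rational.Solver using (module +-*-Solver)
open import Data.List using (List; []; _∷_; length; map)
open import Data.List.Membership.Propositional using (_∈_)
open import Data.List.Relation.Unary.Any using (here; there)
open import Data.Product using (_×_; _,_; proj₁; proj₂; ∃)
open import Data.Sum as Sum using (_⊎_; inj₁; inj₂)
open import Relation.Nullary using (¬_; yes; no; contradiction)
open import Relation.Unary using (Decidable)
open import Relation.Binary using (tri<; tri≈; tri>)
open import Relation.Binary.PropositionalEquality

-- Coefficients and degrees

infix 4 _≐_

-- Insensitive to trailing zeros, so products and compositions never have to be normalised by
-- `trim`.
_≐_ : Poly → Poly → Set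
f ≐ g = ∀ i → coeff f i ≡ coeff g i

DegAtMost : Poly → ℕ → Set
DegAtMost f m = ∀ i → m < i → coeff f i ≡ 0ℚ

IsZero : Poly → Set
IsZero f = ∀ i → coeff f i ≡ 0ℚ

coeff-trim : ∀ f → trim f ≐ f
coeff-trim [] i = refl
coeff-trim (a ∷ f) i with trim f | coeff-trim f
coeff-trim (a ∷ f) i | [] | ih with a ℚ.≟ 0ℚ
coeff-trim (a ∷ f) zero | [] | ih | yes a≡0 = sym a≡0
coeff-trim (a ∷ f) (suc i) | [] | ih | yes a≡0 = ih i
coeff-trim (a ∷ f) zero | [] | ih | no _ = refl
coeff-trim (a ∷ f) (suc i) | [] | ih | no _ = ih i
coeff-trim (a ∷ f) zero | b ∷ g | ih = refl
coeff-trim (a ∷ f) (suc i) | b ∷ g | ih = ih i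

≈ₚ⇒≐ : ∀ {f g} → f ≈ₚ g → f ≐ g
≈ₚ⇒≐ {f} {g} eq i = begin
  coeff f i        ≡⟨ coeff-trim f i ⟨
  coeff (trim f) i ≡⟨ cong (λ h → coeff h i) eq ⟩
  coeff (trim g) i ≡⟨ coeff-trim g i ⟩
  coeff g i        ∎
  where open ≡-Reasoning

coeff-length : ∀ f i → length f ≤ i → coeff f i ≡ 0ℚ
coeff-length []      i       _       = refl
coeff-length (a ∷ f) (suc i) (s≤s l) = coeff-length f i l

trim-last : ∀ f {b g} → trim f ≡ b ∷ g → coeff (b ∷ g) (length g) ≢ 0ℚ
trim-last (a ∷ f) eq with trim f in tf
trim-last (a ∷ f) eq | [] with a ℚ.≟ 0ℚ
trim-last (a ∷ f) () | [] | yes _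
trim-last (a ∷ f) refl | [] | no a≢0 = a≢0
trim-last (a ∷ f) refl | b ∷ g = trim-last f tf

degAtMost-deg : ∀ f → DegAtMost f (deg f)
degAtMost-deg f i d<i = trans (sym (coeff-trim f i)) (coeff-length (trim f) i (bound (trim f) d<i))
  where
  bound : ∀ (t : Poly) → length t ∸ 1 < i → length t ≤ i
  bound []      _ = z≤n
  bound (_ ∷ _) l = l

-- `deg` is 0 for the zero polynomial too, so that convention has to be separated from a genuine
-- leading coefficient.
zero-or-lead : ∀ f → (deg f ≡ 0 × IsZero f) ⊎ coeff f (deg f) ≢ 0ℚ
zero-or-lead f with trim f in tf | coeff-trim f
... | []    | ct = inj₁ (refl , λ i → sym (ct i))
... | b ∷ g | ct = inj₂ λ eq → trim-last f tf (trans (ct (length g)) eq)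

coeff≢0⇒lead≢0 : ∀ f {i} → coeff f i ≢ 0ℚ → coeff f (deg f) ≢ 0ℚ
coeff≢0⇒lead≢0 f {i} fi≢0 with zero-or-lead f
... | inj₁ (_ , z) = contradiction (z i) fi≢0
... | inj₂ l = l

deg≥1⇒lead≢0 : ∀ f → 1 ≤ deg f → coeff f (deg f) ≢ 0ℚ
deg≥1⇒lead≢0 f 1≤d with zero-or-lead f
... | inj₁ (d≡0 , _) = contradiction (subst (1 ≤_) d≡0 1≤d) λ ()
... | inj₂ l = l

lead≢0⇒deg≡ : ∀ f m → DegAtMost f m → coeff f m ≢ 0ℚ → deg f ≡ m
lead≢0⇒deg≡ f m f≤m fm≢0 = ℕ.≤-antisym
  (ℕ.≮⇒≥ λ m<d → coeff≢0⇒lead≢0 f {m} fm≢0 (f≤m _ m<d))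
  (ℕ.≮⇒≥ λ d<m → fm≢0 (degAtMost-deg f _ d<m))

-- Coefficients of sums, products and compositions.

coeff-+ : ∀ f g i → coeff (f +ₚ g) i ≡ coeff f i ℚ.+ coeff g i
coeff-+ []      g       i       = sym (ℚ.+-identityˡ _)
coeff-+ (a ∷ f) []      i       = sym (ℚ.+-identityʳ _)
coeff-+ (a ∷ f) (b ∷ g) zero    = refl
coeff-+ (a ∷ f) (b ∷ g) (suc i) = coeff-+ f g i

coeff-map : ∀ a g i → coeff (map (a ℚ.*_) g) i ≡ a ℚ.* coeff g i
coeff-map a []      i       = sym (ℚ.*-zeroʳ a)
coeff-map a (b ∷ g) zero    = refl
coeff-map a (b ∷ g) (suc i) = coeff-map a g i

coeff-cons* : ∀ a f g i →
  coeff ((a ∷ f) *ₚ g) i ≡ a ℚ.* coeff g i ℚ.+ coeff (0ℚ ∷ (f *ₚ g)) i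
coeff-cons* a f g i = trans (coeff-+ (map (a ℚ.*_) g) _ i) (cong (ℚ._+ _) (coeff-map a g i))

coeff-*-zero : ∀ f g → coeff (f *ₚ g) 0 ≡ coeff f 0 ℚ.* coeff g 0
coeff-*-zero []      g = sym (ℚ.*-zeroˡ (coeff g 0))
coeff-*-zero (a ∷ f) g = trans (coeff-cons* a f g 0) (ℚ.+-identityʳ _)

-- `_*ₚ_` recurses on its left factor; this is the matching recursion on the right factor, used to
-- drop the constant term of the second factor.
coeff-*cons : ∀ f b g i →
  coeff (f *ₚ (b ∷ g)) (suc i) ≡ coeff f (suc i) ℚ.* b ℚ.+ coeff (f *ₚ g) i
coeff-*cons []      b g i = sym (trans (ℚ.+-identityʳ _) (ℚ.*-zeroˡ b))
coeff-*cons (a ∷ f) b g i = begin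
  coeff ((a ∷ f) *ₚ (b ∷ g)) (suc i)
    ≡⟨ coeff-cons* a f (b ∷ g) (suc i) ⟩
  a ℚ.* coeff g i ℚ.+ coeff (f *ₚ (b ∷ g)) i
    ≡⟨ cong (a ℚ.* coeff g i ℚ.+_) (tail i) ⟩
  a ℚ.* coeff g i ℚ.+ (coeff f i ℚ.* b ℚ.+ coeff (0ℚ ∷ (f *ₚ g)) i)
    ≡⟨ solve 3 (λ x y z → x :+ (y :+ z) := y :+ (x :+ z)) refl
         (a ℚ.* coeff g i) (coeff f i ℚ.* b) (coeff (0ℚ ∷ (f *ₚ g)) i) ⟩
  coeff f i ℚ.* b ℚ.+ (a ℚ.* coeff g i ℚ.+ coeff (0ℚ ∷ (f *ₚ g)) i)
    ≡⟨ cong (coeff f i ℚ.* b ℚ.+_) (coeff-cons* a f g i) ⟨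
  coeff f i ℚ.* b ℚ.+ coeff ((a ∷ f) *ₚ g) i ∎
  where
  open ≡-Reasoning
  open +-*-Solver
  tail : ∀ i → coeff (f *ₚ (b ∷ g)) i ≡ coeff f i ℚ.* b ℚ.+ coeff (0ℚ ∷ (f *ₚ g)) i
  tail zero    = trans (coeff-*-zero f (b ∷ g)) (sym (ℚ.+-identityʳ _))
  tail (suc i) = coeff-*cons f b g i

zero-cons : ∀ {a f} → a ≡ 0ℚ → IsZero f → IsZero (a ∷ f)
zero-cons a≡0 z zero    = a≡0
zero-cons a≡0 z (suc i) = z i

zero-*ₚ : ∀ f g → IsZero f → IsZero (f *ₚ g)
zero-*ₚ []      g z i = refl
zero-*ₚ (a ∷ f) g z i = trans (coeff-cons* a f g i)
  (trans (cong₂ ℚ._+_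
      (trans (cong (ℚ._* coeff g i) (z 0)) (ℚ.*-zeroˡ (coeff g i)))
      (zero-cons refl (zero-*ₚ f g (λ j → z (suc j))) i))
    (ℚ.+-identityʳ 0ℚ))

*ₚ-zero : ∀ f g → IsZero g → IsZero (f *ₚ g)
*ₚ-zero []      g z i = refl
*ₚ-zero (a ∷ f) g z i = trans (coeff-cons* a f g i)
  (trans (cong₂ ℚ._+_
      (trans (cong (a ℚ.*_) (z i)) (ℚ.*-zeroʳ a))
      (zero-cons refl (*ₚ-zero f g z) i))
    (ℚ.+-identityʳ 0ℚ))

coeff-const* : ∀ a f g → IsZero f → ∀ i → coeff ((a ∷ f) *ₚ g) i ≡ a ℚ.* coeff g i
coeff-const* a f g z i = trans (coeff-cons* a f g i)
  (trans (cong (a ℚ.* coeff g i ℚ.+_) (zero-cons refl (zero-*ₚ f g z) i)) (ℚ.+-identityʳ _))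

degAtMost-* : ∀ f g m n → DegAtMost f m → DegAtMost g n → DegAtMost (f *ₚ g) (m + n)
degAtMost-* []      g m n _ _ i _ = refl
degAtMost-* (a ∷ f) g zero n f≤ g≤ i n<i =
  trans (coeff-const* a f g (λ j → f≤ (suc j) (s≤s z≤n)) i)
    (trans (cong (a ℚ.*_) (g≤ i n<i)) (ℚ.*-zeroʳ a))
degAtMost-* (a ∷ f) g (suc m) n f≤ g≤ (suc i) (s≤s m+n<i) =
  trans (coeff-cons* a f g (suc i)) (trans
    (cong₂ ℚ._+_
      (trans (cong (a ℚ.*_) (g≤ (suc i) (ℕ.m≤n⇒m≤1+n (ℕ.≤-trans (s≤s (ℕ.m≤n+m n m)) m+n<i)))) (ℚ.*-zeroʳ a))
      (degAtMost-* f g m n (λ j m<j → f≤ (suc j) (s≤s m<j)) g≤ i m+n<i))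
    (ℚ.+-identityʳ 0ℚ))

lead-* : ∀ f g m n → DegAtMost f m → DegAtMost g n →
  coeff (f *ₚ g) (m + n) ≡ coeff f m ℚ.* coeff g n
lead-* []      g m n _ _ = sym (ℚ.*-zeroˡ (coeff g n))
lead-* (a ∷ f) g zero n f≤ g≤ = coeff-const* a f g (λ j → f≤ (suc j) (s≤s z≤n)) n
lead-* (a ∷ f) g (suc m) n f≤ g≤ =
  trans (coeff-cons* a f g (suc (m + n))) (trans
    (cong₂ ℚ._+_
      (trans (cong (a ℚ.*_) (g≤ _ (s≤s (ℕ.m≤n+m n m)))) (ℚ.*-zeroʳ a))
      (lead-* f g m n (λ j m<j → f≤ (suc j) (s≤s m<j)) g≤))
    (ℚ.+-identityˡ _))

zero-∘ₚ : ∀ f g → IsZero f → IsZero (f ∘ₚ g)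
zero-∘ₚ []      g z i = refl
zero-∘ₚ (a ∷ f) g z i = trans (coeff-+ (a ∷ []) (g *ₚ (f ∘ₚ g)) i)
  (trans (cong₂ ℚ._+_
      (zero-cons (z 0) (λ _ → refl) i)
      (*ₚ-zero g _ (zero-∘ₚ f g (λ j → z (suc j))) i))
    (ℚ.+-identityʳ 0ℚ))

coeff-∘-suc : ∀ a f g i → coeff ((a ∷ f) ∘ₚ g) (suc i) ≡ coeff (g *ₚ (f ∘ₚ g)) (suc i)
coeff-∘-suc a f g i = trans (coeff-+ (a ∷ []) (g *ₚ (f ∘ₚ g)) (suc i)) (ℚ.+-identityˡ _)

coeff-∘-zero : ∀ a f g → coeff ((a ∷ f) ∘ₚ g) 0 ≡ a ℚ.+ coeff g 0 ℚ.* coeff (f ∘ₚ g) 0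
coeff-∘-zero a f g = trans (coeff-+ (a ∷ []) (g *ₚ (f ∘ₚ g)) 0) (cong (a ℚ.+_) (coeff-*-zero g (f ∘ₚ g)))

degAtMost-∘ : ∀ f g m n → DegAtMost f m → DegAtMost g n → DegAtMost (f ∘ₚ g) (m * n)
degAtMost-∘ []      g m n _ _ i _ = refl
degAtMost-∘ (a ∷ f) g zero n f≤ g≤ (suc i) _ = trans (coeff-∘-suc a f g i)
  (*ₚ-zero g (f ∘ₚ g) (zero-∘ₚ f g (λ j → f≤ (suc j) (s≤s z≤n))) (suc i))
degAtMost-∘ (a ∷ f) g (suc m) n f≤ g≤ (suc i) l = trans (coeff-∘-suc a f g i)
  (degAtMost-* g (f ∘ₚ g) n (m * n) g≤
    (degAtMost-∘ f g m n (λ j m<j → f≤ (suc j) (s≤s m<j)) g≤) (suc i) l)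

-- p-adic valuation

ι : ℤ → ℚ
ι z = z ℚ./ 1

toℚᵘ-ι : ∀ z → ℚ.toℚᵘ (ι z) ℚᵘ.≃ mkℚᵘ z 0
toℚᵘ-ι z = ℚ.toℚᵘ-fromℚᵘ (mkℚᵘ z 0)

ι-+ : ∀ x y → ι (x ℤ.+ y) ≡ ι x ℚ.+ ι y
ι-+ x y = ℚ.toℚᵘ-injective (begin
  ℚ.toℚᵘ (ι (x ℤ.+ y))              ≈⟨ toℚᵘ-ι (x ℤ.+ y) ⟩
  mkℚᵘ (x ℤ.+ y) 0                  ≈⟨ *≡* (lemma x y) ⟩
  mkℚᵘ x 0 ℚᵘ.+ mkℚᵘ y 0            ≈⟨ ℚᵘ.+-cong (toℚᵘ-ι x) (toℚᵘ-ι y) ⟨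
  ℚ.toℚᵘ (ι x) ℚᵘ.+ ℚ.toℚᵘ (ι y)    ≈⟨ ℚ.toℚᵘ-homo-+ (ι x) (ι y) ⟨
  ℚ.toℚᵘ (ι x ℚ.+ ι y)              ∎)
  where
  open ℚᵘ.≃-Reasoning
  lemma : ∀ x y → (x ℤ.+ y) ℤ.* 1ℤ ≡ (x ℤ.* 1ℤ ℤ.+ y ℤ.* 1ℤ) ℤ.* 1ℤ
  lemma = solve-∀

ι-* : ∀ x y → ι (x ℤ.* y) ≡ ι x ℚ.* ι y
ι-* x y = ℚ.toℚᵘ-injective (begin
  ℚ.toℚᵘ (ι (x ℤ.* y))              ≈⟨ toℚᵘ-ι (x ℤ.* y) ⟩
  mkℚᵘ x 0 ℚᵘ.* mkℚᵘ y 0            ≈⟨ ℚᵘ.*-cong (toℚᵘ-ι x) (toℚᵘ-ι y) ⟨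
  ℚ.toℚᵘ (ι x) ℚᵘ.* ℚ.toℚᵘ (ι y)    ≈⟨ ℚ.toℚᵘ-homo-* (ι x) (ι y) ⟨
  ℚ.toℚᵘ (ι x ℚ.* ι y)              ∎)
  where open ℚᵘ.≃-Reasoning

ι-injective : ∀ {x y} → ι x ≡ ι y → x ≡ y
ι-injective {x} {y} eq with ℚ.fromℚᵘ-injective {mkℚᵘ x 0} {mkℚᵘ y 0} eq
... | *≡* e = trans (sym (ℤ.*-identityʳ x)) (trans e (ℤ.*-identityʳ y))

*-denominator : ∀ q → q ℚ.* ι (ℚ.denominator q) ≡ ι (ℚ.numerator q)
*-denominator q@record{} = ℚ.toℚᵘ-injective (begin
  ℚ.toℚᵘ (q ℚ.* ι d)            ≈⟨ ℚ.toℚᵘ-homo-* q (ι d) ⟩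
  ℚ.toℚᵘ q ℚᵘ.* ℚ.toℚᵘ (ι d)    ≈⟨ ℚᵘ.*-congˡ {ℚ.toℚᵘ q} (toℚᵘ-ι d) ⟩
  ℚ.toℚᵘ q ℚᵘ.* mkℚᵘ d 0        ≈⟨ *≡* (trans (ℤ.*-identityʳ _)
                                           (cong (ℚ.numerator q ℤ.*_)
                                             (sym (cong +_ (ℕ.*-identityʳ (ℚ.denominatorℕ q)))))) ⟩
  mkℚᵘ (ℚ.numerator q) 0        ≈⟨ toℚᵘ-ι (ℚ.numerator q) ⟨
  ℚ.toℚᵘ (ι (ℚ.numerator q))    ∎)
  where
  open ℚᵘ.≃-Reasoning
  d = ℚ.denominator q

i≤∣i∣ : ∀ i → i ℤ.≤ + ∣ i ∣
i≤∣i∣ (+ n)      = ℤ.≤-refl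
i≤∣i∣ ℤ.-[1+ n ] = ℤ.-≤+

-- A downward search from `n`. It finds the exact power of a prime dividing a number.
last-holding : ∀ {P : ℕ → Set} → Decidable P → P 0 → ∀ n → ¬ P n → ∃ λ k → P k × ¬ P (suc k)
last-holding P? p₀ zero    ¬p = contradiction p₀ ¬p
last-holding P? p₀ (suc n) ¬p with P? n
... | yes p = n , p , ¬p
... | no ¬q = last-holding P? p₀ n ¬q

-- Supplies the start of that search: `m ^ n` is too large to divide a nonzero `n`.
n<m^n : ∀ m n → 1 < m → n < m ^ n
n<m^n m zero    1<m = s≤s z≤n
n<m^n m@(suc _) (suc n) 1<m = ℕ.≤-<-trans (n<m^n m n 1<m)
  (subst (m ^ n <_) (ℕ.*-comm (m ^ n) m) (ℕ.m<m*n (m ^ n) m {{ℕ.m^n≢0 m n}} 1<m))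

module Valuation {p : ℕ} (p-prime : Prime p) where

  P : ℤ
  P = + p

  instance
    p≢0 : ℕ.NonZero p
    p≢0 = prime⇒nonZero p-prime

  ∣P^∣ : ∀ k → ∣ P ℤ.^ k ∣ ≡ p ^ k
  ∣P^∣ zero    = refl
  ∣P^∣ (suc k) = trans (ℤ.abs-* P (P ℤ.^ k)) (cong (p *_) (∣P^∣ k))

  P^≢0 : ∀ k → ℤ.NonZero (P ℤ.^ k)
  P^≢0 k = subst ℕ.NonZero (sym (∣P^∣ k)) (ℕ.m^n≢0 p k)

  P^-regroup : ∀ k l x y → P ℤ.^ (k + l) ℤ.* (x ℤ.* y) ≡ P ℤ.^ k ℤ.* x ℤ.* (P ℤ.^ l ℤ.* y)
  P^-regroup k l x y =
    trans (cong (ℤ._* (x ℤ.* y)) (ℤ.^-distribˡ-+-* P k l)) (interchange (P ℤ.^ k) (P ℤ.^ l) x y)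
    where
    interchange : ∀ x y z w → x ℤ.* y ℤ.* (z ℤ.* w) ≡ x ℤ.* z ℤ.* (y ℤ.* w)
    interchange = solve-∀

  ∤-* : ∀ {a b} → ¬ P ∣ a → ¬ P ∣ b → ¬ P ∣ a ℤ.* b
  ∤-* {a} {b} ¬a ¬b P∣ab with euclidsLemma ∣ a ∣ ∣ b ∣ p-prime (subst (p ℕ.∣_) (ℤ.abs-* a b) (∣⇒∣ᵤ P∣ab))
  ... | inj₁ p∣a = ¬a (∣ᵤ⇒∣ p∣a)
  ... | inj₂ p∣b = ¬b (∣ᵤ⇒∣ p∣b)

  -- q = p^v · a/b with b prime to p; clearing denominators, v is split as m − n.
  record Rep (q : ℚ) (v : ℤ) (a : ℤ) : Set where
    constructor rep
    field
      b     : ℤ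
      m n   : ℕ
      P∤b   : ¬ P ∣ b
      v≡m-n : v ≡ + m ℤ.- + n
      eqn   : q ℚ.* ι (P ℤ.^ n ℤ.* b) ≡ ι (P ℤ.^ m ℤ.* a)

  -- This is ν(q) ≥ v, with ν(0) = ∞, because `a` may be any integer; `Val` turns it into an
  -- equality by asking that p not divide `a`.
  Ge : ℚ → ℤ → Set
  Ge q v = ∃ (Rep q v)

  Val : ℚ → ℤ → Set
  Val q v = ∃ λ a → ¬ P ∣ a × Rep q v a

  Val⇒Ge : ∀ {q v} → Val q v → Ge q v
  Val⇒Ge (a , _ , x) = a , x

  Val-resp : ∀ {q q′ v} → q ≡ q′ → Val q v → Val q′ v
  Val-resp refl x = x

  Ge-resp : ∀ {q q′ v} → q ≡ q′ → Ge q v → Ge q′ v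
  Ge-resp refl x = x

  rep-* : ∀ {q q′ v v′ a a′} → Rep q v a → Rep q′ v′ a′ → Rep (q ℚ.* q′) (v ℤ.+ v′) (a ℤ.* a′)
  rep-* {q} {q′} {a = a} {a′} (rep b m n P∤b refl e) (rep b′ m′ n′ P∤b′ refl e′) =
    rep (b ℤ.* b′) (m + m′) (n + n′) (∤-* P∤b P∤b′)
      (trans (exponents (+ m) (+ n) (+ m′) (+ n′)) (sym (cong₂ ℤ._-_ (ℤ.pos-+ m m′) (ℤ.pos-+ n n′))))
      (begin
        q ℚ.* q′ ℚ.* ι (P ℤ.^ (n + n′) ℤ.* (b ℤ.* b′))
          ≡⟨ cong (λ z → q ℚ.* q′ ℚ.* ι z) (P^-regroup n n′ b b′) ⟩
        q ℚ.* q′ ℚ.* ι (P ℤ.^ n ℤ.* b ℤ.* (P ℤ.^ n′ ℤ.* b′))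
          ≡⟨ cong (q ℚ.* q′ ℚ.*_) (ι-* (P ℤ.^ n ℤ.* b) (P ℤ.^ n′ ℤ.* b′)) ⟩
        q ℚ.* q′ ℚ.* (ι (P ℤ.^ n ℤ.* b) ℚ.* ι (P ℤ.^ n′ ℤ.* b′))
          ≡⟨ solve 4 (λ x y z w → x :* y :* (z :* w) := x :* z :* (y :* w)) refl
               q q′ (ι (P ℤ.^ n ℤ.* b)) (ι (P ℤ.^ n′ ℤ.* b′)) ⟩
        q ℚ.* ι (P ℤ.^ n ℤ.* b) ℚ.* (q′ ℚ.* ι (P ℤ.^ n′ ℤ.* b′))
          ≡⟨ cong₂ ℚ._*_ e e′ ⟩
        ι (P ℤ.^ m ℤ.* a) ℚ.* ι (P ℤ.^ m′ ℤ.* a′)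
          ≡⟨ ι-* (P ℤ.^ m ℤ.* a) (P ℤ.^ m′ ℤ.* a′) ⟨
        ι (P ℤ.^ m ℤ.* a ℤ.* (P ℤ.^ m′ ℤ.* a′))
          ≡⟨ cong ι (P^-regroup m m′ a a′) ⟨
        ι (P ℤ.^ (m + m′) ℤ.* (a ℤ.* a′)) ∎)
    where
    open ≡-Reasoning
    open +-*-Solver using (solve; _:*_; _:=_)
    exponents : ∀ x y z w → (x ℤ.- y) ℤ.+ (z ℤ.- w) ≡ (x ℤ.+ z) ℤ.- (y ℤ.+ w)
    exponents = solve-∀

  same-exponent : ∀ m n m′ n′ → + m ℤ.- + n ≡ + m′ ℤ.- + n′ → m′ + n ≡ m + n′
  same-exponent m n m′ n′ eq = ℤ.+-injective (begin
    + (m′ + n)                      ≡⟨ ℤ.pos-+ m′ n ⟩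
    + m′ ℤ.+ + n                    ≡⟨ split (+ m′) (+ n) (+ n′) ⟩
    (+ m′ ℤ.- + n′) ℤ.+ + n′ ℤ.+ + n ≡⟨ cong (λ v → v ℤ.+ + n′ ℤ.+ + n) eq ⟨
    (+ m ℤ.- + n) ℤ.+ + n′ ℤ.+ + n  ≡⟨ join (+ m) (+ n) (+ n′) ⟩
    + m ℤ.+ + n′                    ≡⟨ ℤ.pos-+ m n′ ⟨
    + (m + n′)                      ∎)
    where
    open ≡-Reasoning
    split : ∀ x y z → x ℤ.+ y ≡ (x ℤ.- z) ℤ.+ z ℤ.+ y
    split = solve-∀
    join : ∀ x y z → (x ℤ.- y) ℤ.+ z ℤ.+ y ≡ x ℤ.+ z
    join = solve-∀

  -- Addition over a common denominator. The numerator is kept explicit because `Val-+` inspects it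
  -- modulo p.
  rep-+ : ∀ {q q′ v a a′} (x : Rep q v a) (y : Rep q′ v a′) →
    Rep (q ℚ.+ q′) v (a ℤ.* Rep.b y ℤ.+ a′ ℤ.* Rep.b x)
  rep-+ {q} {q′} {v} {a} {a′} (rep b m n P∤b v≡ e) (rep b′ m′ n′ P∤b′ v≡′ e′) =
    rep (b ℤ.* b′) (m + n′) (n + n′) (∤-* P∤b P∤b′)
      (trans v≡ (trans (widen (+ m) (+ n) (+ n′)) (sym (cong₂ ℤ._-_ (ℤ.pos-+ m n′) (ℤ.pos-+ n n′)))))
      (begin
        (q ℚ.+ q′) ℚ.* ι (P ℤ.^ (n + n′) ℤ.* (b ℤ.* b′))
          ≡⟨ cong (λ z → (q ℚ.+ q′) ℚ.* ι z) (P^-regroup n n′ b b′) ⟩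
        (q ℚ.+ q′) ℚ.* ι (B ℤ.* B′)
          ≡⟨ cong ((q ℚ.+ q′) ℚ.*_) (ι-* B B′) ⟩
        (q ℚ.+ q′) ℚ.* (ι B ℚ.* ι B′)
          ≡⟨ solve 4 (λ x y z w → (x :+ y) :* (z :* w) := (x :* z) :* w :+ (y :* w) :* z) refl
               q q′ (ι B) (ι B′) ⟩
        (q ℚ.* ι B) ℚ.* ι B′ ℚ.+ (q′ ℚ.* ι B′) ℚ.* ι B
          ≡⟨ cong₂ (λ x y → x ℚ.* ι B′ ℚ.+ y ℚ.* ι B) e e′ ⟩
        ι (P ℤ.^ m ℤ.* a) ℚ.* ι B′ ℚ.+ ι (P ℤ.^ m′ ℤ.* a′) ℚ.* ι B
          ≡⟨ cong₂ ℚ._+_ (ι-* (P ℤ.^ m ℤ.* a) B′) (ι-* (P ℤ.^ m′ ℤ.* a′) B) ⟨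
        ι (P ℤ.^ m ℤ.* a ℤ.* B′) ℚ.+ ι (P ℤ.^ m′ ℤ.* a′ ℤ.* B)
          ≡⟨ ι-+ (P ℤ.^ m ℤ.* a ℤ.* B′) (P ℤ.^ m′ ℤ.* a′ ℤ.* B) ⟨
        ι (P ℤ.^ m ℤ.* a ℤ.* B′ ℤ.+ P ℤ.^ m′ ℤ.* a′ ℤ.* B)
          ≡⟨ cong ι (cong₂ ℤ._+_ (P^-regroup m n′ a b′) (P^-regroup m′ n a′ b)) ⟨
        ι (P ℤ.^ (m + n′) ℤ.* (a ℤ.* b′) ℤ.+ P ℤ.^ (m′ + n) ℤ.* (a′ ℤ.* b))
          ≡⟨ cong (λ k → ι (P ℤ.^ (m + n′) ℤ.* (a ℤ.* b′) ℤ.+ P ℤ.^ k ℤ.* (a′ ℤ.* b)))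
               (same-exponent m n m′ n′ (trans (sym v≡) v≡′)) ⟩
        ι (P ℤ.^ (m + n′) ℤ.* (a ℤ.* b′) ℤ.+ P ℤ.^ (m + n′) ℤ.* (a′ ℤ.* b))
          ≡⟨ cong ι (ℤ.*-distribˡ-+ (P ℤ.^ (m + n′)) (a ℤ.* b′) (a′ ℤ.* b)) ⟨
        ι (P ℤ.^ (m + n′) ℤ.* (a ℤ.* b′ ℤ.+ a′ ℤ.* b)) ∎)
    where
    open ≡-Reasoning
    open +-*-Solver using (solve; _:*_; _:+_; _:=_)
    B B′ : ℤ
    B = P ℤ.^ n ℤ.* b
    B′ = P ℤ.^ n′ ℤ.* b′
    widen : ∀ x y z → x ℤ.- y ≡ (x ℤ.+ z) ℤ.- (y ℤ.+ z)
    widen = solve-∀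

  -- Lowering the exponent moves `P ℤ.^ k` into the numerator, where divisibility by p becomes
  -- visible.
  rep-lower : ∀ {q v a} k → Rep q (v ℤ.+ + k) a → Rep q v (P ℤ.^ k ℤ.* a)
  rep-lower {q} {v} {a} k (rep b m n P∤b v≡ e) =
    rep b m (n + k) P∤b
      (trans (unshift v (+ k)) (trans (cong (ℤ._- + k) v≡)
        (trans (collect (+ m) (+ n) (+ k)) (cong (λ z → + m ℤ.- z) (sym (ℤ.pos-+ n k))))))
      (begin
        q ℚ.* ι (P ℤ.^ (n + k) ℤ.* b)
          ≡⟨ cong (λ z → q ℚ.* ι z)
               (trans (cong (ℤ._* b) (ℤ.^-distribˡ-+-* P n k)) (swap (P ℤ.^ n) (P ℤ.^ k) b)) ⟩
        q ℚ.* ι (P ℤ.^ n ℤ.* b ℤ.* P ℤ.^ k)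
          ≡⟨ cong (q ℚ.*_) (ι-* (P ℤ.^ n ℤ.* b) (P ℤ.^ k)) ⟩
        q ℚ.* (ι (P ℤ.^ n ℤ.* b) ℚ.* ι (P ℤ.^ k))
          ≡⟨ ℚ.*-assoc q (ι (P ℤ.^ n ℤ.* b)) (ι (P ℤ.^ k)) ⟨
        q ℚ.* ι (P ℤ.^ n ℤ.* b) ℚ.* ι (P ℤ.^ k)
          ≡⟨ cong (ℚ._* ι (P ℤ.^ k)) e ⟩
        ι (P ℤ.^ m ℤ.* a) ℚ.* ι (P ℤ.^ k)
          ≡⟨ ι-* (P ℤ.^ m ℤ.* a) (P ℤ.^ k) ⟨
        ι (P ℤ.^ m ℤ.* a ℤ.* P ℤ.^ k)
          ≡⟨ cong ι (move (P ℤ.^ m) a (P ℤ.^ k)) ⟩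
        ι (P ℤ.^ m ℤ.* (P ℤ.^ k ℤ.* a)) ∎)
    where
    open ≡-Reasoning
    unshift : ∀ x y → x ≡ x ℤ.+ y ℤ.- y
    unshift = solve-∀
    collect : ∀ x y z → x ℤ.- y ℤ.- z ≡ x ℤ.- (y ℤ.+ z)
    collect = solve-∀
    swap : ∀ x y z → x ℤ.* y ℤ.* z ≡ x ℤ.* z ℤ.* y
    swap = solve-∀
    move : ∀ x y z → x ℤ.* y ℤ.* z ≡ x ℤ.* (z ℤ.* y)
    move = solve-∀

  ≤⇒∃+ : ∀ {v w} → v ℤ.≤ w → ∃ λ k → w ≡ v ℤ.+ + k
  ≤⇒∃+ {v} {w} v≤w = ∣ w ℤ.- v ∣ ,
    trans (recover v w) (cong (λ z → v ℤ.+ z) (sym (ℤ.0≤i⇒+∣i∣≡i (ℤ.i≤j⇒0≤j-i v≤w))))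
    where
    recover : ∀ v w → w ≡ v ℤ.+ (w ℤ.- v)
    recover = solve-∀

  Ge-mono : ∀ {q v w} → v ℤ.≤ w → Ge q w → Ge q v
  Ge-mono v≤w (a , x) with ≤⇒∃+ v≤w
  ... | k , refl = P ℤ.^ k ℤ.* a , rep-lower k x

  Ge-+ : ∀ {q q′ v} → Ge q v → Ge q′ v → Ge (q ℚ.+ q′) v
  Ge-+ (_ , x) (_ , y) = _ , rep-+ x y

  Ge-* : ∀ {q q′ v v′} → Ge q v → Ge q′ v′ → Ge (q ℚ.* q′) (v ℤ.+ v′)
  Ge-* (_ , x) (_ , y) = _ , rep-* x y

  Val-* : ∀ {q q′ v v′} → Val q v → Val q′ v′ → Val (q ℚ.* q′) (v ℤ.+ v′)
  Val-* (_ , P∤a , x) (_ , P∤a′ , y) = _ , ∤-* P∤a P∤a′ , rep-* x y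

  -- At exponent `v` the second numerator is a multiple of p, so if p divided the sum of the cross
  -- products it would divide the first one, a product of integers prime to p.
  Val-+ : ∀ {q q′ v} → Val q v → Ge q′ (v ℤ.+ 1ℤ) → Val (q ℚ.+ q′) v
  Val-+ (a , P∤a , x) (a′ , y) = _ , P∤num , rep-+ x y↓
    where
    y↓ = rep-lower 1 y
    P∤num : ¬ P ∣ a ℤ.* Rep.b y ℤ.+ P ℤ.^ 1 ℤ.* a′ ℤ.* Rep.b x
    P∤num P∣num = ∤-* P∤a (Rep.P∤b y) (ℤ.∣m+n∣n⇒∣m {n = P ℤ.^ 1 ℤ.* a′ ℤ.* Rep.b x} P∣num
      (ℤ.∣m⇒∣m*n (Rep.b x) (ℤ.∣m⇒∣m*n a′ (ℤ.∣-reflexive (sym (ℤ.^-identityʳ P))))))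

  -- Multiplying `q` by both denominators in either order gives two integer expressions, from which
  -- the common power of p cancels.
  rep-cross : ∀ {q v a a′} (x : Rep q v a) (y : Rep q v a′) → a ℤ.* Rep.b y ≡ a′ ℤ.* Rep.b x
  rep-cross {q} {v} {a} {a′} (rep b m n P∤b v≡ e) (rep b′ m′ n′ P∤b′ v≡′ e′) =
    ℤ.*-cancelˡ-≡ (P ℤ.^ (m + n′)) _ _ {{P^≢0 (m + n′)}} (begin
      P ℤ.^ (m + n′) ℤ.* (a ℤ.* b′)          ≡⟨ P^-regroup m n′ a b′ ⟩
      P ℤ.^ m ℤ.* a ℤ.* B′                   ≡⟨ ι-injective in-ℚ ⟩
      P ℤ.^ m′ ℤ.* a′ ℤ.* B                  ≡⟨ P^-regroup m′ n a′ b ⟨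
      P ℤ.^ (m′ + n) ℤ.* (a′ ℤ.* b)          ≡⟨ cong (λ k → P ℤ.^ k ℤ.* (a′ ℤ.* b))
                                                  (same-exponent m n m′ n′ (trans (sym v≡) v≡′)) ⟩
      P ℤ.^ (m + n′) ℤ.* (a′ ℤ.* b)          ∎)
    where
    open ≡-Reasoning
    open +-*-Solver using (solve; _:*_; _:=_)
    B B′ : ℤ
    B = P ℤ.^ n ℤ.* b
    B′ = P ℤ.^ n′ ℤ.* b′
    in-ℚ : ι (P ℤ.^ m ℤ.* a ℤ.* B′) ≡ ι (P ℤ.^ m′ ℤ.* a′ ℤ.* B)
    in-ℚ = begin
      ι (P ℤ.^ m ℤ.* a ℤ.* B′)        ≡⟨ ι-* (P ℤ.^ m ℤ.* a) B′ ⟩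
      ι (P ℤ.^ m ℤ.* a) ℚ.* ι B′      ≡⟨ cong (ℚ._* ι B′) e ⟨
      q ℚ.* ι B ℚ.* ι B′              ≡⟨ solve 3 (λ x y z → x :* y :* z := x :* z :* y) refl q (ι B) (ι B′) ⟩
      q ℚ.* ι B′ ℚ.* ι B              ≡⟨ cong (ℚ._* ι B) e′ ⟩
      ι (P ℤ.^ m′ ℤ.* a′) ℚ.* ι B     ≡⟨ ι-* (P ℤ.^ m′ ℤ.* a′) B ⟨
      ι (P ℤ.^ m′ ℤ.* a′ ℤ.* B)       ∎

  -- If `w` exceeded `v`, then `q` would also have a representation at exponent `v` with numerator
  -- divisible by p, which `rep-cross` rules out.
  Val-max : ∀ {q v w} → Val q v → Ge q w → w ℤ.≤ v
  Val-max {q} {v} {w} (a , P∤a , x) ge = ℤ.≮⇒≥ λ v<w →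
    let a′ , y = Ge-mono (subst (ℤ._≤ w) (ℤ.+-comm 1ℤ v) (ℤ.i<j⇒suc[i]≤j v<w)) ge
        y↓ = rep-lower 1 y
    in ∤-* P∤a (Rep.P∤b y) (subst (P ∣_) (sym (rep-cross x y↓))
         (ℤ.∣m⇒∣m*n (Rep.b x) (ℤ.∣m⇒∣m*n a′ (ℤ.∣-reflexive (sym (ℤ.^-identityʳ P))))))

  -- Comparison with `ValN` and `ValQ`; existence of valuations.

  ValN⇒split : ∀ z k → ValN p ∣ z ∣ k → ∃ λ a → ¬ P ∣ a × z ≡ P ℤ.^ k ℤ.* a
  ValN⇒split z k (p^k∣z , p^1+k∤z) with ∣ᵤ⇒∣ {P ℤ.^ k} {z} (subst (ℕ._∣ ∣ z ∣) (sym (∣P^∣ k)) p^k∣z)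
  ... | divides a z≡aP^k = a , P∤a , trans z≡aP^k (ℤ.*-comm a _)
    where
    P∤a : ¬ P ∣ a
    P∤a (divides c a≡cP) = p^1+k∤z (subst (ℕ._∣ ∣ z ∣) (∣P^∣ (suc k))
      (∣⇒∣ᵤ (divides c (trans z≡aP^k (trans (cong (ℤ._* P ℤ.^ k) a≡cP) (ℤ.*-assoc c P _))))))

  ValQ⇒Val : ∀ {q v} → ValQ p q v → Val q v
  ValQ⇒Val {q} (k₁ , k₂ , val₁ , val₂ , v≡)
    with ValN⇒split (ℚ.numerator q) k₁ val₁ | ValN⇒split (ℚ.denominator q) k₂ val₂
  ... | a , P∤a , num≡ | b , P∤b , den≡ = a , P∤a , rep b k₁ k₂ P∤b v≡
    (trans (cong (λ z → q ℚ.* ι z) (sym den≡)) (trans (*-denominator q) (cong ι num≡)))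

  ValN-exists : ∀ n .{{_ : ℕ.NonZero n}} → ∃ (ValN p n)
  ValN-exists n = last-holding (λ k → (p ^ k) ℕ.∣? n) (ℕ.1∣ n) n
    (ℕ.>⇒∤ (n<m^n p n (ℕ.nonTrivial⇒n>1 p {{prime⇒nonTrivial p-prime}})))

  Val-exists : ∀ {q} → q ≢ 0ℚ → ∃ (Val q)
  Val-exists {q@record{}} q≢0 =
    let k₁ , val₁ = ValN-exists ∣ ℚ.numerator q ∣ {{ℕ.≢-nonZero λ z → q≢0 (ℚ.↥p≡0⇒p≡0 q (ℤ.∣i∣≡0⇒i≡0 z))}}
        k₂ , val₂ = ValN-exists (ℚ.denominatorℕ q)
    in _ , ValQ⇒Val {q} (k₁ , k₂ , val₁ , val₂ , refl)

  P∤1 : ¬ P ∣ 1ℤ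
  P∤1 P∣1 = ℕ.>⇒∤ (ℕ.nonTrivial⇒n>1 p {{prime⇒nonTrivial p-prime}}) (∣⇒∣ᵤ P∣1)

  rep-int : ∀ z → Rep (ι z) 0ℤ z
  rep-int z = rep 1ℤ 0 0 P∤1 refl (trans (ℚ.*-identityʳ (ι z)) (cong ι (sym (ℤ.*-identityˡ z))))

  Val-1 : Val 1ℚ 0ℤ
  Val-1 = 1ℤ , P∤1 , rep-int 1ℤ

  Ge-0 : ∀ v → Ge 0ℚ v
  Ge-0 v = 0ℤ , rep 1ℤ (proj₁ parts) (proj₁ (proj₂ parts)) P∤1 (proj₂ (proj₂ parts))
    (trans (ℚ.*-zeroˡ (ι (P ℤ.^ proj₁ (proj₂ parts) ℤ.* 1ℤ))) (cong ι (sym (ℤ.*-zeroʳ (P ℤ.^ proj₁ parts)))))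
    where
    difference : ∀ v → ∃ λ m → ∃ λ n → v ≡ + m ℤ.- + n
    difference (+ m)      = m , 0 , sym (ℤ.+-identityʳ (+ m))
    difference ℤ.-[1+ n ] = 0 , suc n , refl
    parts = difference v

  Val≢0 : ∀ {q v} → Val q v → q ≢ 0ℚ
  Val≢0 {q} {v} val refl =
    ℤ.<⇒≱ (ℤ.suc[i]≤j⇒i<j ℤ.≤-refl) (Val-max val (Ge-0 (ℤ.suc v)))

-- Weighted Gauss valuation

module Weights {p : ℕ} (p-prime : Prime p) where
  open Valuation p-prime

  -- A · ν(q) ≥ e, where ν(0) = ∞.
  record AGe (A : ℕ) (q : ℚ) (e : ℤ) : Set where
    constructor mkAGe
    field
      v  : ℤ
      ge : Ge q v
      e≤ : e ℤ.≤ + A ℤ.* v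

  AGe-0 : ∀ A .{{_ : ℕ.NonZero A}} e → AGe A 0ℚ e
  -- Any large valuation serves for zero; |e| is enough because A ≥ 1.
  AGe-0 A@(suc A-1) e = mkAGe (+ ∣ e ∣) (Ge-0 _) (ℤ.≤-trans (i≤∣i∣ e)
    (subst (+ ∣ e ∣ ℤ.≤_) (ℤ.pos-* A ∣ e ∣) (ℤ.+≤+ (ℕ.m≤m+n ∣ e ∣ (A-1 * ∣ e ∣)))))

  AGe-resp : ∀ {A q q′ e} → q ≡ q′ → AGe A q e → AGe A q′ e
  AGe-resp refl x = x

  AGe-mono : ∀ {A q e e′} → e′ ℤ.≤ e → AGe A q e → AGe A q e′
  AGe-mono e′≤e (mkAGe v ge e≤) = mkAGe v ge (ℤ.≤-trans e′≤e e≤)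

  AGe-+ : ∀ {A q q′ e} → AGe A q e → AGe A q′ e → AGe A (q ℚ.+ q′) e
  AGe-+ {A} (mkAGe v ge e≤) (mkAGe v′ ge′ e≤′) with ℤ.≤-total v v′
  ... | inj₁ v≤v′ = mkAGe v (Ge-+ ge (Ge-mono v≤v′ ge′)) e≤
  ... | inj₂ v′≤v = mkAGe v′ (Ge-+ (Ge-mono v′≤v ge) ge′) e≤′

  AGe-* : ∀ {A q q′ e e′} → AGe A q e → AGe A q′ e′ → AGe A (q ℚ.* q′) (e ℤ.+ e′)
  AGe-* {A} {e = e} {e′} (mkAGe v ge e≤) (mkAGe v′ ge′ e≤′) = mkAGe (v ℤ.+ v′) (Ge-* ge ge′)
    (subst (e ℤ.+ e′ ℤ.≤_) (sym (ℤ.*-distribˡ-+ (+ A) v v′)) (ℤ.+-mono-≤ e≤ e≤′))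

  AGe-cancel : ∀ {A q q′ e} → AGe A (q ℚ.+ q′) e → AGe A q e → AGe A q′ e
  AGe-cancel {A} {q} {q′} {e} s x = subst (λ z → AGe A z e)
    (solve 2 (λ x y → x :+ y :+ :- x := y) refl q q′)
    (AGe-+ s (subst (λ z → AGe A z e) (neg q) (subst (AGe A _) (ℤ.+-identityˡ e) (AGe-* minus-one x))))
    where
    open +-*-Solver using (solve; _:+_; :-_; _:=_)
    minus-one : AGe A (ι ℤ.-1ℤ) 0ℤ
    minus-one = mkAGe 0ℤ (ℤ.-1ℤ , rep-int ℤ.-1ℤ) (ℤ.≤-reflexive (sym (ℤ.*-zeroʳ (+ A))))
    neg : ∀ q → ι ℤ.-1ℤ ℚ.* q ≡ ℚ.- q
    neg q = trans (sym (ℚ.neg-distribˡ-* 1ℚ q)) (cong ℚ.-_ (ℚ.*-identityˡ q))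

  AGe-Val : ∀ {A q e v} → Val q v → AGe A q e → e ℤ.≤ + A ℤ.* v
  AGe-Val {A} val (mkAGe w ge e≤) = ℤ.≤-trans e≤ (ℤ.*-monoˡ-≤-nonNeg (+ A) (Val-max val ge))

  -- A change of unit, which brings polygons of slopes with denominators `A` and `k * A` onto a
  -- common scale.
  AGe-scale : ∀ {A q e} k → AGe A q e → AGe (k * A) q (+ k ℤ.* e)
  AGe-scale {A} {q} {e} k (mkAGe v ge e≤) = mkAGe v ge (subst (+ k ℤ.* e ℤ.≤_)
    (trans (sym (ℤ.*-assoc (+ k) (+ A) v)) (cong (ℤ._* v) (sym (ℤ.pos-* k A))))
    (ℤ.*-monoˡ-≤-nonNeg (+ k) e≤))

  -- Weights are integers, so a bound that is not attained improves by a whole unit.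
  AGe-suc-or-exact : ∀ {A} .{{_ : ℕ.NonZero A}} {q e} → AGe A q e →
    AGe A q (ℤ.suc e) ⊎ (∃ λ v → Val q v × e ≡ + A ℤ.* v)
  AGe-suc-or-exact {A} {q} {e} x with q ℚ.≟ 0ℚ
  ... | yes refl = inj₁ (AGe-0 A (ℤ.suc e))
  ... | no q≢0 with Val-exists q≢0
  ...   | v , val with e ℤ.≟ + A ℤ.* v
  ...     | yes e≡ = inj₂ (v , val , e≡)
  ...     | no e≢ = inj₁ (mkAGe v (Val⇒Ge val) (ℤ.i<j⇒suc[i]≤j (ℤ.≤∧≢⇒< (AGe-Val val x) e≢)))

  AGe-exact-* : ∀ {A q q′ v v′} → Val q v → Val q′ v′ →
    ¬ AGe A (q ℚ.* q′) (ℤ.suc (+ A ℤ.* v ℤ.+ + A ℤ.* v′))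
  AGe-exact-* {A} {v = v} {v′} val val′ x = ℤ.<⇒≱ (ℤ.suc[i]≤j⇒i<j ℤ.≤-refl)
    (subst (ℤ.suc (+ A ℤ.* v ℤ.+ + A ℤ.* v′) ℤ.≤_) (ℤ.*-distribˡ-+ (+ A) v v′) (AGe-Val (Val-* val val′) x))

  -- Newton-polygon bound: the points (i , ν(fᵢ)) lie on or above the line A y + B x = c.
  record W (A : ℕ) (B : ℤ) (f : Poly) (c : ℤ) : Set where
    constructor mkW
    field at : ∀ i → AGe A (coeff f i) (c ℤ.- B ℤ.* + i)
  open W

  at-zero : ∀ c B → c ℤ.- B ℤ.* 0ℤ ≡ c
  at-zero = solve-∀

  at-suc : ∀ c B i → c ℤ.- B ℤ.* + suc i ≡ c ℤ.- B ℤ.- B ℤ.* + i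
  at-suc c B i = trans (cong (λ z → c ℤ.- B ℤ.* z) (ℤ.pos-+ 1 i)) (lemma c B (+ i))
    where
    lemma : ∀ c B z → c ℤ.- B ℤ.* (1ℤ ℤ.+ z) ≡ c ℤ.- B ℤ.- B ℤ.* z
    lemma = solve-∀

  W-head : ∀ {A B f c} → W A B f c → AGe A (coeff f 0) c
  W-head {A} {B} {f} {c} w = subst (AGe A (coeff f 0)) (at-zero c B) (at w 0)

  -- Dropping the constant term lowers every index by one, hence the intercept by `B`.
  W-tail : ∀ {A B a f c} → W A B (a ∷ f) c → W A B f (c ℤ.- B)
  W-tail {A} {B} {a} {f} {c} w = mkW λ i → subst (AGe A (coeff f i)) (at-suc c B i) (at w (suc i))

  W-cons : ∀ {A B a f c} → AGe A a c → W A B f (c ℤ.- B) → W A B (a ∷ f) c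
  at (W-cons {A} {B} {a} {f} {c} x w) zero = subst (AGe A a) (sym (at-zero c B)) x
  at (W-cons {A} {B} {a} {f} {c} x w) (suc i) = subst (AGe A (coeff f i)) (sym (at-suc c B i)) (at w i)

  W-mono : ∀ {A B f c c′} → c′ ℤ.≤ c → W A B f c → W A B f c′
  W-mono {B = B} c′≤c w = mkW λ i → AGe-mono (ℤ.+-monoˡ-≤ (ℤ.- (B ℤ.* + i)) c′≤c) (at w i)

  W-resp : ∀ {A B f g c} → f ≐ g → W A B f c → W A B g c
  W-resp {A} f≐g w = mkW λ i → AGe-resp (f≐g i) (at w i)

  W-[] : ∀ {A} .{{_ : ℕ.NonZero A}} {B c} → W A B [] c
  W-[] {A} = mkW λ i → AGe-0 A _

  W-+ : ∀ {A B c} f g → W A B f c → W A B g c → W A B (f +ₚ g) c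
  W-+ {A} f g wf wg = mkW λ i → AGe-resp (sym (coeff-+ f g i)) (AGe-+ (at wf i) (at wg i))

  W-map : ∀ {A B a g e c} → AGe A a e → W A B g c → W A B (map (a ℚ.*_) g) (e ℤ.+ c)
  W-map {A} {B} {a} {g} {e} {c} x w = mkW λ i →
    subst₂ (AGe A) (sym (coeff-map a g i)) (sym (ℤ.+-assoc e c (ℤ.- (B ℤ.* + i)))) (AGe-* x (at w i))

  W-* : ∀ {A} .{{_ : ℕ.NonZero A}} {B} f g {c c′} → W A B f c → W A B g c′ → W A B (f *ₚ g) (c ℤ.+ c′)
  W-* []      g wf wg = W-[]
  W-* {A} {B} (a ∷ f) g {c} {c′} wf wg = W-+ (map (a ℚ.*_) g) (0ℚ ∷ (f *ₚ g))
    (W-map {g = g} (W-head wf) wg)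
    (W-cons (AGe-0 A _) (subst (W A B (f *ₚ g)) (lemma c B c′) (W-* f g (W-tail wf) wg)))
    where
    lemma : ∀ c B c′ → c ℤ.- B ℤ.+ c′ ≡ c ℤ.+ c′ ℤ.- B
    lemma = solve-∀

  -- Horner's scheme: each `x` in `f` is replaced by a polynomial of weight at least `e`, so `e` is
  -- the slope with which `f` has to be weighed.
  W-∘ : ∀ {A} .{{_ : ℕ.NonZero A}} {B e} f g {c} → W A e f c → W A B g e → W A B (f ∘ₚ g) c
  W-∘ []      g wf wg = W-[]
  W-∘ {A} {B} {e} (a ∷ f) g {c} wf wg = W-+ (a ∷ []) (g *ₚ (f ∘ₚ g))
    (W-cons (W-head wf) W-[])
    (subst (W A B (g *ₚ (f ∘ₚ g))) (lemma e c) (W-* g (f ∘ₚ g) wg (W-∘ f g (W-tail wf) wg)))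
    where
    lemma : ∀ e c → e ℤ.+ (c ℤ.- e) ≡ c
    lemma = solve-∀

  -- A polynomial has finitely many coefficients; the minimum of their weights starts the descent in
  -- `gauss`.
  W-exists : ∀ {A} .{{_ : ℕ.NonZero A}} {B} f → ∃ (W A B f)
  W-exists [] = 0ℤ , W-[]
  W-exists {A} {B} (a ∷ f) with W-exists {A} {B} f | ge a
    where
    ge : ∀ q → ∃ (AGe A q)
    ge q with q ℚ.≟ 0ℚ
    ... | yes refl = 0ℤ , AGe-0 A 0ℤ
    ... | no q≢0 with Val-exists q≢0
    ...   | v , val = + A ℤ.* v , mkAGe v (Val⇒Ge val) ℤ.≤-refl
  ... | c , w | e , x = e ℤ.⊓ (c ℤ.+ B) ,
    W-cons (AGe-mono (ℤ.i⊓j≤i e _) x)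
      (W-mono (subst (e ℤ.⊓ (c ℤ.+ B) ℤ.- B ℤ.≤_) (lemma c B) (ℤ.+-monoˡ-≤ (ℤ.- B) (ℤ.i⊓j≤j e _))) w)
    where
    lemma : ∀ c B → c ℤ.+ B ℤ.- B ≡ c
    lemma = solve-∀

  -- Gauss's lemma for weights.

  module _ {A : ℕ} .{{_ : ℕ.NonZero A}} {B : ℤ} where

    private
      pull : ∀ c c′ B → (1ℤ ℤ.+ (c ℤ.+ c′)) ℤ.- B ≡ (1ℤ ℤ.+ ((c ℤ.- B) ℤ.+ c′))
      pull = solve-∀
      pull′ : ∀ c c′ B → (1ℤ ℤ.+ (c ℤ.+ c′)) ℤ.- B ≡ (1ℤ ℤ.+ (c ℤ.+ (c′ ℤ.- B)))
      pull′ = solve-∀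
      pull₁ : ∀ c B → (1ℤ ℤ.+ c) ℤ.- B ≡ (1ℤ ℤ.+ (c ℤ.- B))
      pull₁ = solve-∀
      sucˡ : ∀ c c′ → (1ℤ ℤ.+ c) ℤ.+ c′ ≡ (1ℤ ℤ.+ (c ℤ.+ c′))
      sucˡ = solve-∀
      sucʳ : ∀ c c′ z → (1ℤ ℤ.+ c′) ℤ.+ (c ℤ.- z) ≡ (1ℤ ℤ.+ (c ℤ.+ c′)) ℤ.- z
      sucʳ = solve-∀

    -- The classes {W ≥ c} modulo {W ≥ c + 1} form a domain: when the constant terms both attain
    -- the minimal weight so does the constant term of the product, and otherwise one may drop a term.
    W-prime-exact : ∀ f g {v c′} → Val (coeff f 0) v → W A B f (+ A ℤ.* v) → W A B g c′ →
      W A B (f *ₚ g) (ℤ.suc (+ A ℤ.* v ℤ.+ c′)) → W A B g (ℤ.suc c′)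
    W-prime-exact f []      val wf wg wfg = W-[]
    W-prime-exact f (b ∷ g) {v} {c′} val wf wg wfg with AGe-suc-or-exact (W-head wg)
    ... | inj₁ x = W-cons x (subst (W A B g) (sym (pull₁ c′ B))
      (W-prime-exact f g val wf (W-tail wg) rest))
      where
      c = + A ℤ.* v
      shift : ∀ i → ℤ.suc (c ℤ.+ c′) ℤ.- B ℤ.* + suc i ≡ ℤ.suc (c ℤ.+ (c′ ℤ.- B)) ℤ.- B ℤ.* + i
      shift i = trans (at-suc (ℤ.suc (c ℤ.+ c′)) B i) (cong (ℤ._- B ℤ.* + i) (pull′ c c′ B))
      -- Since `b` lies strictly above the line, `b` times `f` has weight beyond that of the product
      -- bound and can be subtracted.
      rest : W A B (f *ₚ g) (ℤ.suc (c ℤ.+ (c′ ℤ.- B)))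
      rest = mkW λ i → AGe-cancel {q = coeff f (suc i) ℚ.* b}
        (subst₂ (AGe A) (coeff-*cons f b g i) (shift i) (at wfg (suc i)))
        (subst₂ (AGe A) (ℚ.*-comm b (coeff f (suc i)))
          (trans (sucʳ c c′ (B ℤ.* + suc i)) (shift i)) (AGe-* x (at wf (suc i))))
    ... | inj₂ (v′ , val′ , refl) = contradiction
      (AGe-resp (coeff-*-zero f (b ∷ g)) (W-head wfg))
      (AGe-exact-* val val′)

    -- Terms of `f` of weight above `c` are peeled off until the constant term attains `c`;
    -- `W-prime-exact` then peels `g`, where meeting a term of weight exactly `c′` is contradictory.
    W-prime : ∀ f g {c c′} → W A B f c → W A B g c′ → W A B (f *ₚ g) (ℤ.suc (c ℤ.+ c′)) →
      W A B f (ℤ.suc c) ⊎ W A B g (ℤ.suc c′)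
    W-prime []      g wf wg wfg = inj₁ W-[]
    W-prime (a ∷ f) g {c} {c′} wf wg wfg with AGe-suc-or-exact (W-head wf)
    ... | inj₂ (v , val , refl) = inj₂ (W-prime-exact (a ∷ f) g val wf wg wfg)
    ... | inj₁ x with W-prime f g (W-tail wf) wg (subst (W A B (f *ₚ g)) (pull c c′ B) (W-tail {a = 0ℚ} rest))
      where
      rest : W A B (0ℚ ∷ (f *ₚ g)) (ℤ.suc (c ℤ.+ c′))
      rest = mkW λ i → AGe-cancel {q = a ℚ.* coeff g i}
        (AGe-resp (coeff-cons* a f g i) (at wfg i))
        (subst (AGe A (a ℚ.* coeff g i))
          (trans (sym (ℤ.+-assoc (ℤ.suc c) c′ _)) (cong (ℤ._- B ℤ.* + i) (sucˡ c c′))) (AGe-* x (at wg i)))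
    ... | inj₁ wf′ = inj₁ (W-cons x (subst (W A B f) (sym (pull₁ c B)) wf′))
    ... | inj₂ wg′ = inj₂ wg′

    -- While `c + c′` falls short of `e`, `W-prime` raises one of the two by 1; `k` bounds the
    -- shortfall and serves as fuel.
    gauss-descent : ∀ k f g {c c′ e} → W A B f c → W A B g c′ → e ℤ.≤ c ℤ.+ c′ ℤ.+ + k → W A B (f *ₚ g) e →
      ∃ λ c₁ → ∃ λ c₁′ → W A B f c₁ × W A B g c₁′ × e ℤ.≤ c₁ ℤ.+ c₁′
    gauss-descent zero f g {c} {c′} {e} wf wg e≤ wfg =
      c , c′ , wf , wg , subst (e ℤ.≤_) (ℤ.+-identityʳ _) e≤
    gauss-descent (suc k) f g {c} {c′} {e} wf wg e≤ wfg with e ℤ.≤? c ℤ.+ c′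
    ... | yes e≤c+c′ = c , c′ , wf , wg , e≤c+c′
    ... | no e≰ with W-prime f g wf wg (W-mono (ℤ.i<j⇒suc[i]≤j (ℤ.≰⇒> e≰)) wfg)
    ... | inj₁ wf′ = gauss-descent k f g wf′ wg (subst (e ℤ.≤_) (shiftˡ c c′ (+ k)) e≤) wfg
      where
      shiftˡ : ∀ c c′ k → c ℤ.+ c′ ℤ.+ (1ℤ ℤ.+ k) ≡ (1ℤ ℤ.+ c) ℤ.+ c′ ℤ.+ k
      shiftˡ = solve-∀
    ... | inj₂ wg′ = gauss-descent k f g wf wg′ (subst (e ℤ.≤_) (shiftʳ c c′ (+ k)) e≤) wfg
      where
      shiftʳ : ∀ c c′ k → c ℤ.+ c′ ℤ.+ (1ℤ ℤ.+ k) ≡ c ℤ.+ (1ℤ ℤ.+ c′) ℤ.+ k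
      shiftʳ = solve-∀

    -- The converse of `W-*`: together they make the weight multiplicative.
    gauss : ∀ f g {e} → W A B (f *ₚ g) e →
      ∃ λ c → ∃ λ c′ → W A B f c × W A B g c′ × e ℤ.≤ c ℤ.+ c′
    gauss f g {e} wfg with W-exists f | W-exists g
    ... | c , wf | c′ , wg = gauss-descent ∣ e ℤ.- (c ℤ.+ c′) ∣ f g wf wg
      (ℤ.i-j≤0⇒i≤j (subst (ℤ._≤ 0ℤ) (lemma e (c ℤ.+ c′) (+ ∣ e ℤ.- (c ℤ.+ c′) ∣))
        (ℤ.i≤j⇒i-j≤0 (i≤∣i∣ (e ℤ.- (c ℤ.+ c′)))))) wfg
      where
      lemma : ∀ e s k → e ℤ.- s ℤ.- k ≡ e ℤ.- (s ℤ.+ k)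
      lemma = solve-∀

-- Pure polynomials and their iterates

-- In the chain e ≤ c + c′ ≤ x + y = e no inequality can be strict.
pinch : ∀ {e c c′ x y} → e ℤ.≤ c ℤ.+ c′ → c ℤ.≤ x → c′ ℤ.≤ y → x ℤ.+ y ≡ e → x ≡ c × y ≡ c′
pinch {e} {c} {c′} e≤ c≤x c′≤y refl =
  ℤ.≤-antisym (ℤ.≮⇒≥ λ c<x → ℤ.<⇒≱ (ℤ.+-mono-<-≤ c<x c′≤y) e≤) c≤x ,
  ℤ.≤-antisym (ℤ.≮⇒≥ λ c′<y → ℤ.<⇒≱ (ℤ.+-mono-≤-< c≤x c′<y) e≤) c′≤y

-- Brings the height of the segment at `i`, scaled by `D`, into the truncated-subtraction form used
-- by `Pure`.
gap : ∀ r {D i} → i ≤ D → + (r * D) ℤ.- + r ℤ.* + i ≡ + (r * (D ∸ i))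
gap r {D} {i} i≤D = begin
  + (r * D) ℤ.- + r ℤ.* + i        ≡⟨ cong (λ z → + (r * D) ℤ.- z) (ℤ.pos-* r i) ⟨
  + (r * D) ℤ.- + (r * i)          ≡⟨ ℤ.m-n≡m⊖n (r * D) (r * i) ⟩
  (r * D) ℤ.⊖ (r * i)              ≡⟨ ℤ.⊖-≥ (ℕ.*-monoʳ-≤ r i≤D) ⟩
  + (r * D ∸ r * i)                ≡⟨ cong +_ (ℕ.*-distribˡ-∸ r D i) ⟨
  + (r * (D ∸ i))                  ∎
  where open ≡-Reasoning

-- `N` divides both `m * N` and `m * r`, hence their gcd, which is the positive number
-- `m * gcd N r`.
∣r*m⇒≤m*gcd : ∀ {N r m} → 1 ≤ r → 1 ≤ m → N ℕ.∣ r * m → N ≤ m * gcd N r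
∣r*m⇒≤m*gcd {N} {r@(suc _)} {m@(suc _)} _ _ N∣rm = ℕ.∣⇒≤ {{nz}}
  (subst (N ℕ.∣_) (sym (c*gcd[m,n]≡gcd[cm,cn] m N r))
    (gcd-greatest (ℕ.n∣m*n m) (subst (N ℕ.∣_) (ℕ.*-comm r m) N∣rm)))
  where
  nz : ℕ.NonZero (m * gcd N r)
  nz = ℕ.m*n≢0 m (gcd N r) {{_}} {{ℕ.≢-nonZero (gcd[m,n]≢0 N r (inj₂ λ ()))}}

module PureIterates {p : ℕ} (p-prime : Prime p) where
  open Valuation p-prime
  open Weights p-prime
  open W

  Val-unique : ∀ {q v w} → Val q v → Val q w → v ≡ w
  Val-unique x y = ℤ.≤-antisym (Val-max y (Val⇒Ge x)) (Val-max x (Val⇒Ge y))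

  *-≢0 : ∀ {q q′} → q ≢ 0ℚ → q′ ≢ 0ℚ → q ℚ.* q′ ≢ 0ℚ
  *-≢0 q≢0 q′≢0 = Val≢0 (Val-* (proj₂ (Val-exists q≢0)) (proj₂ (Val-exists q′≢0)))

  -- The Newton polygon of f with respect to ν is a single segment of slope − B / A.
  record Balanced (A : ℕ) (B : ℤ) (f : Poly) : Set where
    field
      v₀ v₁   : ℤ
      val₀    : Val (coeff f 0) v₀
      val₁    : Val (coeff f (deg f)) v₁
      balance : + A ℤ.* v₀ ≡ + A ℤ.* v₁ ℤ.+ B ℤ.* + deg f
      bound   : W A B f (+ A ℤ.* v₀)

  module _ {A : ℕ} .{{_ : ℕ.NonZero A}} {B : ℤ} where

    -- Both end coefficients of `f` lie on its line and are products of the end coefficients of `g`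
    -- and `h`. Weights of the factors adding up to at least that of `f` are therefore attained at
    -- both ends of each factor.
    balanced-factors : ∀ {f} g h → f ≐ g *ₚ h → Balanced A B f → Balanced A B g × Balanced A B h
    balanced-factors {f} g h f≐gh bal =
      record { val₀ = G₀ ; val₁ = G₁ ; balance = trans (proj₁ low) (sym (proj₁ high))
             ; bound = subst (W A B g) (sym (proj₁ low)) wg } ,
      record { val₀ = H₀ ; val₁ = H₁ ; balance = trans (proj₂ low) (sym (proj₂ high))
             ; bound = subst (W A B h) (sym (proj₂ low)) wh }
      where
      open Balanced bal
      m = deg g
      n = deg h
      f₀≡ : coeff f 0 ≡ coeff g 0 ℚ.* coeff h 0
      f₀≡ = trans (f≐gh 0) (coeff-*-zero g h)
      g₀≢0 : coeff g 0 ≢ 0ℚ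
      g₀≢0 g₀≡0 = Val≢0 val₀ (trans f₀≡ (trans (cong (ℚ._* coeff h 0) g₀≡0) (ℚ.*-zeroˡ (coeff h 0))))
      h₀≢0 : coeff h 0 ≢ 0ℚ
      h₀≢0 h₀≡0 = Val≢0 val₀ (trans f₀≡ (trans (cong (coeff g 0 ℚ.*_) h₀≡0) (ℚ.*-zeroʳ (coeff g 0))))
      G₀ = proj₂ (Val-exists g₀≢0)
      H₀ = proj₂ (Val-exists h₀≢0)
      G₁ = proj₂ (Val-exists (coeff≢0⇒lead≢0 g {0} g₀≢0))
      H₁ = proj₂ (Val-exists (coeff≢0⇒lead≢0 h {0} h₀≢0))
      f≤m+n : DegAtMost f (m + n)
      f≤m+n i l = trans (f≐gh i) (degAtMost-* g h m n (degAtMost-deg g) (degAtMost-deg h) i l)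
      lead-f : coeff f (m + n) ≡ coeff g m ℚ.* coeff h n
      lead-f = trans (f≐gh (m + n)) (lead-* g h m n (degAtMost-deg g) (degAtMost-deg h))
      F₁ = Val-resp (sym lead-f) (Val-* G₁ H₁)
      deg-f : deg f ≡ m + n
      deg-f = lead≢0⇒deg≡ f (m + n) f≤m+n (Val≢0 F₁)
      bounds = gauss g h (W-resp f≐gh bound)
      c = proj₁ bounds
      c′ = proj₁ (proj₂ bounds)
      wg = proj₁ (proj₂ (proj₂ bounds))
      wh = proj₁ (proj₂ (proj₂ (proj₂ bounds)))
      e≤c+c′ = proj₂ (proj₂ (proj₂ (proj₂ bounds)))
      low = pinch e≤c+c′ (AGe-Val G₀ (W-head wg)) (AGe-Val H₀ (W-head wh))
        (trans (sym (ℤ.*-distribˡ-+ (+ A) _ _))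
          (cong (+ A ℤ.*_) (Val-unique (Val-resp (sym f₀≡) (Val-* G₀ H₀)) val₀)))
      unshift : ∀ {x y z} → x ℤ.- y ℤ.≤ z → x ℤ.≤ z ℤ.+ y
      unshift {x} {y} {z} le = subst (ℤ._≤ z ℤ.+ y) (cancel x y) (ℤ.+-monoˡ-≤ y le)
        where
        cancel : ∀ x y → x ℤ.- y ℤ.+ y ≡ x
        cancel = solve-∀
      regroup : ∀ A x y B m n →
        A ℤ.* x ℤ.+ B ℤ.* m ℤ.+ (A ℤ.* y ℤ.+ B ℤ.* n) ≡ A ℤ.* (x ℤ.+ y) ℤ.+ B ℤ.* (m ℤ.+ n)
      regroup = solve-∀
      -- At the right end the weight includes the term `B` times the degree; `balance` says that it
      -- agrees with the weight at the left end.
      high = pinch e≤c+c′ (unshift (AGe-Val G₁ (at wg m))) (unshift (AGe-Val H₁ (at wh n)))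
        (trans (regroup (+ A) _ _ B (+ m) (+ n))
          (trans (cong₂ (λ v k → + A ℤ.* v ℤ.+ B ℤ.* k)
                   (Val-unique (Val-resp (cong (coeff f) (sym deg-f)) F₁) val₁)
                   (trans (sym (ℤ.pos-+ m n)) (cong +_ (sym deg-f))))
                 (sym balance)))

    balanced-prodₚ : ∀ gs → Balanced A B (prodₚ gs) → ∀ {g} → g ∈ gs → Balanced A B g
    balanced-prodₚ (g ∷ gs) bal (here refl) = proj₁ (balanced-factors g (prodₚ gs) (λ _ → refl) bal)
    balanced-prodₚ (g ∷ gs) bal (there g∈)  =
      balanced-prodₚ gs (proj₂ (balanced-factors g (prodₚ gs) (λ _ → refl) bal)) g∈

  -- Degrees and number of factors.

  balanced⇒deg-bound : ∀ {N r g} → 1 ≤ r → 1 ≤ deg g → Balanced N (+ r) g → N ≤ deg g * gcd N r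
  balanced⇒deg-bound {N} {r} {g} 1≤r 1≤m bal = ∣r*m⇒≤m*gcd 1≤r 1≤m
    (subst (N ℕ.∣_) (ℤ.abs-* (+ r) (+ deg g)) (∣⇒∣ᵤ {+ N} (divides (v₀ ℤ.- v₁)
      (trans (isolate (+ N ℤ.* v₁) _) (trans (cong (ℤ._- + N ℤ.* v₁) (sym balance)) (factor (+ N) v₀ v₁))))))
    where
    open Balanced bal
    isolate : ∀ x y → y ≡ x ℤ.+ y ℤ.- x
    isolate = solve-∀
    factor : ∀ N x y → N ℤ.* x ℤ.- N ℤ.* y ≡ (x ℤ.- y) ℤ.* N
    factor = solve-∀

  -- `M` is the sum of the degrees, and the last component adds up the bounds for the single
  -- factors.
  prodₚ-deg : ∀ {N k} gs → (∀ {g} → g ∈ gs → 1 ≤ deg g × N ≤ deg g * k) →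
    ∃ λ M → DegAtMost (prodₚ gs) M × coeff (prodₚ gs) M ≢ 0ℚ × length gs * N ≤ M * k
  prodₚ-deg [] _ = 0 , (λ { (suc _) _ → refl }) , (λ ()) , z≤n
  prodₚ-deg {N} {k} (g ∷ gs) large with prodₚ-deg gs (λ g∈ → large (there g∈))
  ... | M , gs≤M , lead≢0 , len≤ =
    deg g + M , degAtMost-* g (prodₚ gs) (deg g) M (degAtMost-deg g) gs≤M ,
    (λ eq → *-≢0 (deg≥1⇒lead≢0 g (proj₁ (large (here refl)))) lead≢0
      (trans (sym (lead-* g (prodₚ gs) (deg g) M (degAtMost-deg g) gs≤M)) eq)) ,
    ℕ.≤-trans (ℕ.+-mono-≤ (proj₂ (large (here refl))) len≤) (ℕ.≤-reflexive (sym (ℕ.*-distribʳ-+ k (deg g) M)))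

  factor-count : ∀ {F N k c gs} .{{_ : ℕ.NonZero N}} → DegAtMost F N → coeff F N ≢ 0ℚ →
    F ≐ (c ∷ []) *ₚ prodₚ gs → (∀ {g} → g ∈ gs → 1 ≤ deg g × N ≤ deg g * k) → length gs ≤ k
  factor-count {F} {N} {k} {c} {gs} F≤N F_N≢0 F≐ large with prodₚ-deg gs large
  ... | M , gs≤M , lead≢0 , len≤ = ℕ.*-cancelʳ-≤ (length gs) k N
      (ℕ.≤-trans len≤ (ℕ.≤-reflexive (trans (cong (_* k) M≡N) (ℕ.*-comm N k))))
    where
    F≐c* : ∀ i → coeff F i ≡ c ℚ.* coeff (prodₚ gs) i
    F≐c* i = trans (F≐ i) (coeff-const* c [] (prodₚ gs) (λ _ → refl) i)
    c≢0 : c ≢ 0ℚ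
    c≢0 refl = F_N≢0 (trans (F≐c* N) (ℚ.*-zeroˡ (coeff (prodₚ gs) N)))
    M≡N : M ≡ N
    M≡N = trans (sym (lead≢0⇒deg≡ F M
        (λ i l → trans (F≐c* i) (trans (cong (c ℚ.*_) (gs≤M i l)) (ℚ.*-zeroʳ c)))
        (λ eq → *-≢0 c≢0 lead≢0 (trans (sym (F≐c* M)) eq))))
      (lead≢0⇒deg≡ F N F≤N F_N≢0)

  -- Composition of polynomials above a segment.

  Val-lead-∘ : ∀ f g m n → 1 ≤ n → DegAtMost f m → DegAtMost g n →
    Val (coeff f m) 0ℤ → Val (coeff g n) 0ℤ → Val (coeff (f ∘ₚ g) (m * n)) 0ℤ
  Val-lead-∘ []      g m n _ _ _ vf _ = contradiction refl (Val≢0 vf)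
  Val-lead-∘ (a ∷ f) g zero n _ f≤ g≤ vf vg = Val-resp
    (sym (trans (coeff-∘-zero a f g)
      (trans (cong (λ z → a ℚ.+ coeff g 0 ℚ.* z) (zero-∘ₚ f g (λ j → f≤ (suc j) (s≤s z≤n)) 0))
        (trans (cong (λ z → a ℚ.+ z) (ℚ.*-zeroʳ (coeff g 0))) (ℚ.+-identityʳ a))))) vf
  -- As `n` is positive, the index `n + m * n` is too, and the constant `a` added by the Horner step
  -- does not reach it.
  Val-lead-∘ (a ∷ f) g (suc m) n@(suc n-1) 1≤n f≤ g≤ vf vg = Val-resp
    (sym (trans (coeff-∘-suc a f g (n-1 + m * n)) (lead-* g (f ∘ₚ g) n (m * n) g≤ (degAtMost-∘ f g m n f′≤ g≤))))
    (Val-* vg (Val-lead-∘ f g m n 1≤n f′≤ g≤ vf vg))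
    where
    f′≤ : DegAtMost f m
    f′≤ j m<j = f≤ (suc j) (s≤s m<j)

  AGe⇒Ge : ∀ {A q} .{{_ : ℕ.NonZero A}} v → AGe A q (+ A ℤ.* v) → Ge q v
  AGe⇒Ge {A@(suc _)} v (mkAGe w ge le) = Ge-mono (ℤ.*-cancelˡ-≤-pos v w (+ A) le) ge

  -- Valuations are integers, so a positive fractional bound rounds up to 1.
  AGe⇒Ge1 : ∀ {A q e} → 0ℤ ℤ.< e → AGe A q e → Ge q 1ℤ
  AGe⇒Ge1 {A} 0<e (mkAGe w ge le) = Ge-mono (ℤ.i<j⇒suc[i]≤j
    (ℤ.*-cancelˡ-<-nonNeg (+ A) (subst (ℤ._< + A ℤ.* w) (sym (ℤ.*-zeroʳ (+ A))) (ℤ.<-≤-trans 0<e le)))) ge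

  Ge0-∘ : ∀ f g → (∀ i → Ge (coeff f i) 0ℤ) → Ge (coeff g 0) 0ℤ → Ge (coeff (f ∘ₚ g) 0) 0ℤ
  Ge0-∘ []      g f≥0 y≥0 = Ge-0 0ℤ
  Ge0-∘ (a ∷ f) g f≥0 y≥0 = Ge-resp (sym (coeff-∘-zero a f g))
    (Ge-+ (f≥0 0) (Ge-* y≥0 (Ge0-∘ f g (λ i → f≥0 (suc i)) y≥0)))

  -- f(y) = a₀ + y (a₁ + y h(y)), where ν(a₁) ≥ 1 and ν(y) ≥ r make the second term negligible.
  Val-const-∘ : ∀ {r} f g → 1 ≤ r → Val (coeff f 0) (+ r) → (∀ i → Ge (coeff f i) 0ℤ) → Ge (coeff f 1) 1ℤ →
    Ge (coeff g 0) (+ r) → Val (coeff (f ∘ₚ g) 0) (+ r)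
  Val-const-∘ []      g 1≤r v₀ _ _ _ = contradiction refl (Val≢0 v₀)
  Val-const-∘ {r} (a ∷ f) g 1≤r v₀ f≥0 f₁≥1 y≥r = Val-resp (sym (coeff-∘-zero a f g))
    (Val-+ v₀ (Ge-* y≥r (tail f f≥0 f₁≥1)))
    where
    y≥1 : Ge (coeff g 0) 1ℤ
    y≥1 = Ge-mono (ℤ.+≤+ 1≤r) y≥r
    tail : ∀ f → (∀ i → Ge (coeff (a ∷ f) i) 0ℤ) → Ge (coeff f 0) 1ℤ → Ge (coeff (f ∘ₚ g) 0) 1ℤ
    tail []      _   _    = Ge-0 1ℤ
    tail (b ∷ f) f≥0 b≥1 = Ge-resp (sym (coeff-∘-zero b f g))
      (Ge-+ b≥1 (Ge-* y≥1 (Ge0-∘ f g (λ i → f≥0 (suc (suc i))) (Ge-mono (ℤ.+≤+ z≤n) y≥1))))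

  -- The part of purity that survives every composition: the polygon lies on or above the segment
  -- from (0 , r) to (D , 0) and attains its right end. The left end may rise when the degree is 1.
  record Above (r D : ℕ) (g : Poly) : Set where
    field
      weight : W D (+ r) g (+ (r * D))
      deg≤   : DegAtMost g D
      lead   : Val (coeff g D) 0ℤ

  above-X : ∀ r → Above r 1 (0ℚ ∷ 1ℚ ∷ [])
  above-X r = record
    { weight = W-cons (AGe-0 1 _) (W-cons
        (mkAGe 0ℤ (Val⇒Ge Val-1) (ℤ.≤-reflexive
          (trans (cong (λ z → + z ℤ.- + r) (ℕ.*-identityʳ r)) (ℤ.+-inverseʳ (+ r)))))
        W-[])
    ; deg≤ = λ { (suc zero) (s≤s ()) ; (suc (suc _)) _ → refl }
    ; lead = Val-1
    }

  -- With heights scaled by `d * D` and slope `r`, the inner polynomial has weight at least `r * D`;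
  -- the segment of `f`, scaled by `D`, has precisely this slope, so `W-∘` applies.
  above-∘ : ∀ {r d D f g} .{{_ : ℕ.NonZero d}} .{{_ : ℕ.NonZero D}} →
    Above r d f → Above r D g → Above r (d * D) (f ∘ₚ g)
  above-∘ {r} {d} {D} {f} {g} F G = record
    { weight = W-∘ {e = + (r * D)} f g weight-f weight-g
    ; deg≤   = degAtMost-∘ f g d D F.deg≤ G.deg≤
    ; lead   = Val-lead-∘ f g d D (ℕ.>-nonZero⁻¹ D) F.deg≤ G.deg≤ F.lead G.lead
    }
    where
    module F = Above F
    module G = Above G
    instance
      dD≢0 : ℕ.NonZero (d * D)
      dD≢0 = ℕ.m*n≢0 d D
    distrib : ∀ D c B i → D ℤ.* (c ℤ.- B ℤ.* i) ≡ D ℤ.* c ℤ.- B ℤ.* D ℤ.* i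
    distrib = solve-∀
    weight-f : W (d * D) (+ (r * D)) f (+ (r * (d * D)))
    weight-f = mkW λ i → subst₂ (λ A e → AGe A (coeff f i) e) (ℕ.*-comm D d)
      (trans (distrib (+ D) (+ (r * d)) (+ r) (+ i))
        (cong₂ (λ x y → x ℤ.- y ℤ.* + i)
          (trans (sym (ℤ.pos-* D (r * d))) (cong +_ (trans (ℕ.*-comm D (r * d)) (ℕ.*-assoc r d D))))
          (sym (ℤ.pos-* r D))))
      (AGe-scale D (at F.weight i))
    weight-g : W (d * D) (+ r) g (+ (r * D))
    weight-g = mkW λ j → coefficient j (ℕ.<-cmp D j)
      where
      -- Scaling by `d` gives d r (D - j), which is at least r (D - j) because the latter is
      -- nonnegative for j ≤ D.
      inside : ∀ {j} → j ≤ D → AGe (d * D) (coeff g j) (+ (r * D) ℤ.- + r ℤ.* + j)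
      inside {j} j≤D = AGe-mono
        (subst (λ e → e ℤ.≤ + d ℤ.* e) (sym (gap r j≤D))
          (subst (+ (r * (D ∸ j)) ℤ.≤_) (ℤ.pos-* d _) (ℤ.+≤+ (ℕ.m≤n*m (r * (D ∸ j)) d))))
        (AGe-scale d (at G.weight j))
      coefficient : ∀ j → _ → AGe (d * D) (coeff g j) (+ (r * D) ℤ.- + r ℤ.* + j)
      coefficient j (tri< D<j _ _) = AGe-resp (sym (G.deg≤ j D<j)) (AGe-0 (d * D) _)
      coefficient j (tri≈ _ refl _) = inside ℕ.≤-refl
      coefficient j (tri> _ _ j<D) = inside (ℕ.<⇒≤ j<D)

  Ge-const : ∀ {r D g} .{{_ : ℕ.NonZero D}} → Above r D g → Ge (coeff g 0) (+ r)
  Ge-const {r} {D} {g} G = AGe⇒Ge (+ r) (subst (AGe D (coeff g 0))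
    (trans (cong +_ (ℕ.*-comm r D)) (ℤ.pos-* D r)) (W-head (Above.weight G)))

  Ge-integral : ∀ {r d f} .{{_ : ℕ.NonZero d}} → Above r d f → ∀ i → Ge (coeff f i) 0ℤ
  Ge-integral {r} {d} {f} F i with ℕ.<-cmp d i
  ... | tri< d<i _ _ = Ge-resp (sym (Above.deg≤ F i d<i)) (Ge-0 0ℤ)
  ... | tri≈ _ refl _ = Val⇒Ge (Above.lead F)
  ... | tri> _ _ i<d = AGe⇒Ge 0ℤ (AGe-mono
    (ℤ.≤-trans (ℤ.≤-reflexive (ℤ.*-zeroʳ (+ d))) (subst (0ℤ ℤ.≤_) (sym (gap r (ℕ.<⇒≤ i<d))) (ℤ.+≤+ z≤n)))
    (at (Above.weight F) i))

  -- For d ≥ 2 the segment of `f` has positive height at index 1, so p divides the linear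
  -- coefficient and the constant term of the composite keeps valuation `r`.
  balanced-∘ : ∀ {r d D f g} .{{_ : ℕ.NonZero D}} → 1 ≤ r → 2 ≤ d → Val (coeff f 0) (+ r) →
    Above r d f → Above r D g → Balanced (d * D) (+ r) (f ∘ₚ g)
  balanced-∘ {r} {d@(suc (suc d-2))} {D} {f} {g} 1≤r (s≤s (s≤s _)) v₀ F G = record
    { val₀    = Val-const-∘ f g 1≤r v₀ (Ge-integral F) f₁≥1 (Ge-const G)
    ; val₁    = subst (λ k → Val (coeff (f ∘ₚ g) k) 0ℤ) (sym deg-fg) FG.lead
    ; balance = trans (ℤ.*-comm (+ (d * D)) (+ r)) (trans (cong (λ k → + r ℤ.* + k) (sym deg-fg))
        (sym (trans (cong (ℤ._+ + r ℤ.* + deg (f ∘ₚ g)) (ℤ.*-zeroʳ (+ (d * D)))) (ℤ.+-identityˡ _))))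
    ; bound   = subst (W (d * D) (+ r) (f ∘ₚ g))
        (trans (cong +_ (ℕ.*-comm r (d * D))) (ℤ.pos-* (d * D) r)) FG.weight
    }
    where
    module FG = Above (above-∘ F G)
    deg-fg : deg (f ∘ₚ g) ≡ d * D
    deg-fg = lead≢0⇒deg≡ (f ∘ₚ g) (d * D) FG.deg≤ (Val≢0 FG.lead)
    f₁≥1 : Ge (coeff f 1) 1ℤ
    f₁≥1 = AGe⇒Ge1 (subst (0ℤ ℤ.<_) (sym (gap r {d} {1} (s≤s z≤n)))
      (ℤ.+<+ (ℕ.*-mono-≤ {1} {r} {1} {suc d-2} 1≤r (s≤s z≤n)))) (at (Above.weight F) 1)

  -- Iterates of a pure polynomial and their factors.

  module _ {r : ℕ} (1≤r : 1 ≤ r) {f : Poly} (pure : Pure p r f) where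

    pure-lead : Val (coeff f (deg f)) 0ℤ
    pure-lead = ValQ⇒Val {coeff f (deg f)} (proj₁ pure)

    pure-const : Val (coeff f 0) (+ r)
    pure-const = ValQ⇒Val {coeff f 0} (proj₁ (proj₂ pure))

    -- In degree 0 one coefficient would have valuation both 0 and r ≥ 1.
    pure-deg≢0 : ℕ.NonZero (deg f)
    pure-deg≢0 = ℕ.≢-nonZero λ d≡0 → ℕ.<⇒≢ 1≤r (ℤ.+-injective
      (Val-unique (subst (λ k → Val (coeff f k) 0ℤ) d≡0 pure-lead) pure-const))

    -- The inequalities in `Pure` cover the interior indices; both ends come from the exact
    -- valuations, and higher coefficients vanish.
    pure-above : Above r (deg f) f
    pure-above = record
      { weight = mkW λ i → coefficient i (ℕ.<-cmp (deg f) i)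
      ; deg≤   = degAtMost-deg f
      ; lead   = pure-lead
      }
      where
      instance _ = pure-deg≢0
      d = deg f
      coefficient : ∀ i → _ → AGe d (coeff f i) (+ (r * d) ℤ.- + r ℤ.* + i)
      coefficient i (tri< d<i _ _) = AGe-resp (sym (degAtMost-deg f i d<i)) (AGe-0 d _)
      coefficient i (tri≈ _ refl _) = mkAGe 0ℤ (Val⇒Ge pure-lead) (ℤ.≤-reflexive
        (trans (gap r ℕ.≤-refl) (trans (cong (λ k → + (r * k)) (ℕ.n∸n≡0 d))
          (trans (cong +_ (ℕ.*-zeroʳ r)) (sym (ℤ.*-zeroʳ (+ d)))))))
      coefficient zero (tri> _ _ 0<d) = mkAGe (+ r) (Val⇒Ge pure-const) (ℤ.≤-reflexive
        (trans (gap r z≤n) (trans (cong +_ (ℕ.*-comm r d)) (ℤ.pos-* d r))))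
      coefficient i@(suc _) (tri> _ _ i<d) with proj₂ (proj₂ pure) i (s≤s z≤n) i<d
      ... | inj₁ fi≡0 = AGe-resp (sym fi≡0) (AGe-0 d _)
      ... | inj₂ (v , val , le) = mkAGe v (Val⇒Ge (ValQ⇒Val {coeff f i} val))
        (subst (ℤ._≤ + d ℤ.* v) (sym (gap r (ℕ.<⇒≤ i<d))) le)

    pure-deg^≢0 : ∀ n → ℕ.NonZero (deg f ^ n)
    pure-deg^≢0 n = ℕ.m^n≢0 (deg f) n {{pure-deg≢0}}

    iter-above : ∀ n → Above r (deg f ^ n) (iter f n)
    iter-above zero    = above-X r
    iter-above (suc n) = above-∘ {{pure-deg≢0}} {{pure-deg^≢0 n}} pure-above (iter-above n)

    iter-balanced : ∀ n → 1 ≤ n → deg f ≡ 1 ⊎ Balanced (deg f ^ n) (+ r) (iter f n)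
    iter-balanced (suc n) _ with deg f ℕ.≟ 1
    ... | yes d≡1 = inj₁ d≡1
    ... | no d≢1 = inj₂ (balanced-∘ {{pure-deg^≢0 n}} 1≤r
      (ℕ.≤∧≢⇒< (ℕ.>-nonZero⁻¹ (deg f) {{pure-deg≢0}}) (λ 1≡d → d≢1 (sym 1≡d)))
      pure-const pure-above (iter-above n))

    factor-bound : ∀ n {g} → deg f ≡ 1 ⊎ Balanced (deg f ^ n) (+ r) g → 1 ≤ deg g →
      deg f ^ n ≤ deg g * gcd (deg f ^ n) r
    -- Here `deg f ^ n` is 1, which divides everything.
    factor-bound n (inj₁ d≡1) 1≤m = ∣r*m⇒≤m*gcd 1≤r 1≤m
      (subst (ℕ._∣ _) (sym (trans (cong (_^ n) d≡1) (ℕ.^-zeroˡ n))) (ℕ.1∣ _))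
    factor-bound n (inj₂ bal) 1≤m = balanced⇒deg-bound 1≤r 1≤m bal

    iter-factor-count : ∀ n → 1 ≤ n → ∀ c gs → IrredFactorisation (iter f n) c gs →
      length gs ≤ gcd (deg f ^ n) r
    iter-factor-count n 1≤n c gs (F≈ , irr) =
      factor-count {F = iter f n} {c = c} (Above.deg≤ (iter-above n)) (Val≢0 (Above.lead (iter-above n))) F≐
        λ {g} g∈ → proj₁ (irr g g∈) , factor-bound n
          -- The constant `c` is split off as a first factor, leaving a balanced product of the
          -- irreducible ones.
          (Sum.map₂ (λ bal → balanced-prodₚ gs (proj₂ (balanced-factors (c ∷ []) (prodₚ gs) F≐ bal)) g∈)
            (iter-balanced n 1≤n))
          (proj₁ (irr g g∈))
      where
      F≐ : iter f n ≐ (c ∷ []) *ₚ prodₚ gs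
      F≐ = ≈ₚ⇒≐ {iter f n} {(c ∷ []) *ₚ prodₚ gs} F≈
      instance
        N≢0 : ℕ.NonZero (deg f ^ n)
        N≢0 = pure-deg^≢0 n

    iter-divisor-deg : ∀ n → 1 ≤ n → ∀ g → Irreducible g → g ∣ₚ iter f n →
      deg f ^ n ≤ deg g * gcd (deg f ^ n) r
    iter-divisor-deg n 1≤n g irr (h , F≈) = factor-bound n
      (Sum.map₂
        (λ bal → proj₁ (balanced-factors {{pure-deg^≢0 n}} g h (≈ₚ⇒≐ {iter f n} {g *ₚ h} F≈) bal))
        (iter-balanced n 1≤n))
      (proj₁ irr)

theorem4p9 : (p r : ℕ) → Prime p → 1 ≤ r → (f : Poly) → Pure p r f →
    (((n : ℕ) → 1 ≤ n →
    ((c : ℚ) (gs : List Poly) → IrredFactorisation (iter f n) c gs →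
    length gs ≤ gcd (deg f ^ n) r) ×
    ((g : Poly) → Irreducible g → g ∣ₚ iter f n →
    deg f ^ n ≤ deg g * gcd (deg f ^ n) r))
    × EventuallyStable f)
theorem4p9 p r p-prime 1≤r f pure =
  (λ n 1≤n → iter-factor-count 1≤r pure n 1≤n , iter-divisor-deg 1≤r pure n 1≤n) ,
  r , λ n 1≤n c gs fac →
    ℕ.≤-trans (iter-factor-count 1≤r pure n 1≤n c gs fac) (gcd[m,n]≤n (deg f ^ n) r {{ℕ.>-nonZero 1≤r}})
  where open PureIterates p-prime
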